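{- Let $F$ be a graph with no isolated vertices, with girth $g$ and vertex feedback number $f$. If $g>f$ and $k\geq 3$, then $\mathrm{sat}_k(n,\text{Berge- }F)=O(n)$ as $n\to\infty$.
   Context: The girth of a graph is the length of its shortest cycle; the vertex feedback number is the least number of vertices whose deletion leaves an acyclic graph. A hypergraph $\mathcal{H}$ is a Berge-$F$ if $F$ and $\mathcal{H}$ can be embedded on a common vertex set with a bijection $\phi:E(F)\to E(\mathcal{H})$ such that $e\subseteq\phi(e)$ for all $e\in E(F)$; a hypergraph contains a Berge-$F$ if some subset of its edges forms a Berge-$F$. A $k$-uniform hypergraph $\mathcal{H}$ is Berge-$F$-saturated if it contains no Berge-$F$ but $\mathcal{H}+e$ contains a Berge-$F$ for every $k$-set $e\subseteq V(\mathcal{H})$ with $e\notin E(\mathcal{H})$. $\mathrm{sat}_k(n,\text{Berge- }F)$ is the minimum number of edges in a Berge-$F$-saturated $k$-uniform hypergraph on $n$ vertices. The paper assumes throughout that graphs have no isolated vertices (and have at least one edge). -}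

module Defs where

open import Data.Nat using (ℕ; zero; suc; _+_; _*_; _≤_; _<_)
open import Data.Fin using (Fin; inject₁; fromℕ) renaming (zero to fzero; suc to fsuc; _<_ to _<ᶠ_)
open import Data.Fin.Subset using (Subset; _∈_; _∉_; ∣_∣)
open import Data.List using (List; length; _∷_; lookup)
open import Data.List.Relation.Unary.Unique.Propositional using (Unique)
open import Data.List.Relation.Unary.All using (All)
open import Data.List.Relation.Unary.Any using (Any)
import Data.List.Membership.Propositional as LMem
open import Data.Maybe using (Maybe; just; nothing)
open import Data.Product using (Σ; _×_; _,_; ∃)
open import Data.Sum using (_⊎_)
open import Data.Empty using (⊥)
open import Relation.Nullary using (¬_)
open import Relation.Binary.PropositionalEquality using (_≡_)
open import Function.Definitions using (Injective)

record Graph (m : ℕ) : Set where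
  field
    edges   : List (Fin m × Fin m)
    ordered : All (λ e → Data.Product.proj₁ e <ᶠ Data.Product.proj₂ e) edges
    unique  : Unique edges

open Graph public

Adj : ∀ {m} → Graph m → Fin m → Fin m → Set
Adj F u v = ((u , v) LMem.∈ edges F) ⊎ ((v , u) LMem.∈ edges F)

NoIsolated : ∀ {m} → Graph m → Set
NoIsolated {m} F = (v : Fin m) → ∃ λ u → Adj F v u

HasEdge : ∀ {m} → Graph m → Set
HasEdge F = ∃ λ e → e LMem.∈ edges F

CycleAvoiding : ∀ {m} → Graph m → Subset m → ℕ → Set
CycleAvoiding {m} F S ℓ =
  Σ ℕ λ r → (ℓ ≡ 3 + r) ×
  Σ (Fin (3 + r) → Fin m) λ c →
    Injective _≡_ _≡_ c ×
    ((i : Fin (2 + r)) → Adj F (c (inject₁ i)) (c (fsuc i))) ×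
    Adj F (c (fromℕ (2 + r))) (c fzero) ×
    ((i : Fin (3 + r)) → c i ∉ S)

emptySet : ∀ {m} → Subset m
emptySet = Data.Fin.Subset.⊥

HasCycle : ∀ {m} → Graph m → ℕ → Set
HasCycle F ℓ = CycleAvoiding F emptySet ℓ

-- girth: length of a shortest cycle; `nothing` encodes girth = ∞ (F acyclic)
IsGirth : ∀ {m} → Graph m → Maybe ℕ → Set
IsGirth F (just g) = HasCycle F g × (∀ ℓ → HasCycle F ℓ → g ≤ ℓ)
IsGirth F nothing  = ∀ ℓ → ¬ HasCycle F ℓ

AcyclicAfterDeleting : ∀ {m} → Graph m → Subset m → Set
AcyclicAfterDeleting F S = ∀ ℓ → ¬ CycleAvoiding F S ℓ

IsFeedbackNumber : ∀ {m} → Graph m → ℕ → Set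
IsFeedbackNumber {m} F f =
  (Σ (Subset m) λ S → (∣ S ∣ ≡ f) × AcyclicAfterDeleting F S) ×
  ((S : Subset m) → AcyclicAfterDeleting F S → f ≤ ∣ S ∣)

-- "girth > f" with the convention ∞ > f
GirthGreater : Maybe ℕ → ℕ → Set
GirthGreater (just g) f = f < g
GirthGreater nothing  f = Data.Unit.⊤
  where import Data.Unit

record UHypergraph (k n : ℕ) : Set where
  field
    hedges  : List (Subset n)
    uniform : All (λ e → ∣ e ∣ ≡ k) hedges
    hunique : Unique hedges

open UHypergraph public

-- A list of hyperedges contains a Berge-F: there is an injective embedding
-- ψ of V(F) into the vertex set and an injective map φ from E(F) into the
-- hyperedges (its image being the sub-hypergraph forming the Berge-F) with
-- ψ(e) ⊆ φ(e) for every edge e of F.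
ContainsBerge : ∀ {m n} → Graph m → List (Subset n) → Set
ContainsBerge {m} {n} F E =
  Σ (Fin m → Fin n) λ ψ → Injective _≡_ _≡_ ψ ×
  Σ (Fin (length (edges F)) → Fin (length E)) λ φ → Injective _≡_ _≡_ φ ×
  ((i : Fin (length (edges F))) →
     (ψ (Data.Product.proj₁ (lookup (edges F) i)) ∈ lookup E (φ i)) ×
     (ψ (Data.Product.proj₂ (lookup (edges F) i)) ∈ lookup E (φ i)))

BergeSaturated : ∀ {m k n} → Graph m → UHypergraph k n → Set
BergeSaturated {m} {k} {n} F H =
  ¬ ContainsBerge F (hedges H) ×
  ((e : Subset n) → ∣ e ∣ ≡ k → ¬ (e LMem.∈ hedges H) →
     ContainsBerge F (e ∷ hedges H))

-- sat_k(n, Berge-F) ≤ b : some Berge-F-saturated k-uniform hypergraph on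
-- n vertices has at most b edges (sat is the minimum of these edge counts).
SatAtMost : ∀ {m} → ℕ → ℕ → Graph m → ℕ → Set
SatAtMost k n F b =
  Σ (UHypergraph k n) λ H → BergeSaturated F H × (length (hedges H) ≤ b)

{-# OPTIONS --safe #-}
module Submission where

-- Let W be a smallest feedback set, |W| = f. The base hypergraph has f centres; the other vertices
-- are split into blocks of k - 1 vertices, and every centre together with every block is a
-- hyperedge. (For each pair of centres one further block supports a single hyperedge through both
-- centres.) It is Berge-F-free: if all centres but one are deleted from a Berge copy of F, a
-- remaining cycle uses hyperedges of one block only, of which there are at most f < g, so f - 1
-- vertices would suffice to make F acyclic. Extend the base greedily to a saturated hypergraph H.
-- If H had more than C n hyperedges, it would have a nonempty part of large minimum degree, in
-- which the forest F - W embeds with its vertices in distinct blocks; placing W on the centres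
-- completes a Berge copy of F, because each centre has its own hyperedge to each block.

open import Defs
open import Data.Bool using (Bool; true; false)
import Data.Bool as Bool
open import Data.Nat using (ℕ; zero; suc; _+_; _*_; _^_; _∸_; _≤_; _<_; z≤n; s≤s; s≤s⁻¹; _≤?_; _<?_)
open import Data.Nat.DivMod using (_/_; _%_; m≡m%n+[m/n]*n; m%n<n)
import Data.Nat.Properties as ℕ
open import Data.Nat.Tactic.RingSolver using (solve-∀)
open import Data.Fin
  using (Fin; zero; suc; toℕ; fromℕ; fromℕ<; inject₁; inject≤; splitAt; combine; remQuot; _↑ˡ_; _↑ʳ_; _≟_)
open import Data.Fin.Induction using (<-weakInduction; >-weakInduction)
import Data.Fin.Properties as Fin
open import Data.Fin.Subset using (Subset; _∈_; _∉_; _⊆_; ∣_∣; ∁; _-_; Nonempty; inside; ⊤)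
open import Data.Fin.Subset.Properties
  using (_∈?_; nonempty?; ∉⊥; ∈⊤; ⊆⊤; ∣⊥∣≡0; ∣⊤∣≡n; drop-∷-⊆; p─q⊆p; x∈∁p⇒x∉p; x∉p⇒x∈∁p; x∈p∧x≢y⇒x∈p-y; x∈p⇒∣p-x∣<∣p∣)
open import Data.List
  using (List; []; _∷_; _++_; length; lookup; map; filter; tabulate; allFin; cartesianProductWith; deduplicate)
import Data.List.Membership.DecPropositional as DecMembership
import Data.List.Membership.Propositional as List
open import Data.List.Membership.Propositional.Properties
  using ( ∈-lookup; ∈-map⁺; ∈-map⁻; ∈-++⁺ˡ; ∈-++⁺ʳ; ∈-filter⁺; ∈-filter⁻; ∈-allFin; ∈-tabulate⁺; ∈-tabulate⁻
        ; ∈-cartesianProductWith⁺; ∈-deduplicate⁺; ∈-deduplicate⁻ )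
open import Data.List.Properties using (length-map; length-++; length-tabulate)
open import Data.List.Relation.Unary.All as All using ([]; _∷_)
open import Data.List.Relation.Unary.AllPairs using ([]; _∷_)
open import Data.List.Relation.Unary.Any as Any using (here; there; index)
open import Data.List.Relation.Unary.Any.Properties using (lookup-index)
import Data.List.Relation.Unary.Unique.DecPropositional.Properties as DecUnique
open import Data.List.Relation.Unary.Unique.Propositional using (Unique)
import Data.List.Relation.Unary.Unique.Propositional.Properties as Unique
open import Data.Maybe using (Maybe; just; nothing)
open import Data.Product using (Σ; ∃; _×_; _,_; proj₁; proj₂)
open import Data.Product.Properties using (≡-dec)
open import Data.Sum using (_⊎_; inj₁; inj₂; [_,_]′)
open import Data.Vec as Vec using ([]; _∷_; _[_]≔_; here; there)
import Data.Vec.Properties as Vec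
open import Data.Vec.Functional as Vector using (head; tail)
open import Data.Empty using (⊥; ⊥-elim)
open import Function using (_∘_; id; case_of_)
open import Function.Definitions using (Injective)
open import Relation.Binary.PropositionalEquality
  using (_≡_; _≢_; refl; sym; trans; cong; cong₂; subst; subst₂; _≗_)
open import Relation.Nullary using (¬_; Dec; yes; no; contradiction; does)
open import Relation.Nullary.Decidable using (_×-dec_; _→-dec_; _⊎-dec_; ¬?; map′; decidable-stable; dec-true)
open import Relation.Unary using (Decidable)

private variable
  A : Set
  m n k : ℕ

-- Duplicate-free lists

lookup-injective : {xs : List A} → Unique xs → Injective _≡_ _≡_ (lookup xs)
lookup-injective (_ ∷ _) {zero} {zero} _ = refl
lookup-injective {xs = _ ∷ xs} (x∉ ∷ _) {zero} {suc j} eq = contradiction eq (All.lookup x∉ (∈-lookup j))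
lookup-injective {xs = _ ∷ xs} (x∉ ∷ _) {suc i} {zero} eq = contradiction (sym eq) (All.lookup x∉ (∈-lookup i))
lookup-injective (_ ∷ u) {suc i} {suc j} eq = cong suc (lookup-injective u eq)

index-injective : ∀ {x y} {xs : List A} (p : x List.∈ xs) (q : y List.∈ xs) → index p ≡ index q → x ≡ y
index-injective {xs = xs} p q eq =
  trans (lookup-index p) (trans (cong (lookup xs) eq) (sym (lookup-index q)))

Unique-⊆⇒length≤ : {xs ys : List A} → Unique xs → (∀ {x} → x List.∈ xs → x List.∈ ys) → length xs ≤ length ys
Unique-⊆⇒length≤ {xs = xs} u xs⊆ys =
  Fin.injective⇒≤ {f = λ i → index (xs⊆ys (∈-lookup i))}
    λ eq → lookup-injective u (index-injective (xs⊆ys (∈-lookup _)) (xs⊆ys (∈-lookup _)) eq)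

length-filter-∁ : {P : A → Set} (P? : Decidable P) (xs : List A) →
  length xs ≡ length (filter P? xs) + length (filter (¬? ∘ P?) xs)
length-filter-∁ P? [] = refl
length-filter-∁ P? (x ∷ xs) with P? x
... | yes _ = cong suc (length-filter-∁ P? xs)
... | no  _ = trans (cong suc (length-filter-∁ P? xs)) (sym (ℕ.+-suc _ _))

-- Subsets of a finite set: comprehension, enumeration, insertion, power set

module _ {P : Fin n → Set} (P? : Decidable P) where

  comprehension : Subset n
  comprehension = Vec.tabulate (does ∘ P?)

  ∈-comprehension⁺ : ∀ {x} → P x → x ∈ comprehension
  ∈-comprehension⁺ {x} px = Vec.lookup⇒[]= x _
    (trans (Vec.lookup∘tabulate (does ∘ P?) x) (dec-true (P? x) px))

  ∈-comprehension⁻ : ∀ {x} → x ∈ comprehension → P x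
  ∈-comprehension⁻ {x} x∈ with P? x in eq
  ... | yes px = px
  ... | no ¬px = contradiction
    (trans (sym (Vec.[]=⇒lookup x∈)) (trans (Vec.lookup∘tabulate (does ∘ P?) x) (cong does eq))) λ ()

rank : (p : Subset n) {x : Fin n} → x ∈ p → Fin ∣ p ∣
rank (true ∷ p) here = zero
rank (true ∷ p) (there x∈p) = suc (rank p x∈p)
rank (false ∷ p) (there x∈p) = rank p x∈p

rank-injective : (p : Subset n) {x y : Fin n} (x∈p : x ∈ p) (y∈p : y ∈ p) →
  rank p x∈p ≡ rank p y∈p → x ≡ y
rank-injective (true ∷ p) here here _ = refl
rank-injective (true ∷ p) (there x∈p) (there y∈p) eq = cong suc (rank-injective p x∈p y∈p (Fin.suc-injective eq))
rank-injective (false ∷ p) (there x∈p) (there y∈p) eq = cong suc (rank-injective p x∈p y∈p eq)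

element : (p : Subset n) → Fin ∣ p ∣ → Fin n
element (true ∷ p) zero = zero
element (true ∷ p) (suc i) = suc (element p i)
element (false ∷ p) i = suc (element p i)

element∈ : (p : Subset n) (i : Fin ∣ p ∣) → element p i ∈ p
element∈ (true ∷ p) zero = here
element∈ (true ∷ p) (suc i) = there (element∈ p i)
element∈ (false ∷ p) i = there (element∈ p i)

element-injective : (p : Subset n) → Injective _≡_ _≡_ (element p)
element-injective (true ∷ p) {zero} {zero} _ = refl
element-injective (true ∷ p) {suc i} {suc j} eq = cong suc (element-injective p (Fin.suc-injective eq))
element-injective (false ∷ p) eq = element-injective p (Fin.suc-injective eq)

-- The missed value `z` is free to be the image of one extra point, so a set with one more element
-- than `p` still injects into `Fin k`.
∣p∣<-injection : (p : Subset n) (h : ∀ {x} → x ∈ p → Fin k) →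
  (∀ {x y} (x∈p : x ∈ p) (y∈p : y ∈ p) → h x∈p ≡ h y∈p → x ≡ y) →
  (z : Fin k) → (∀ {x} (x∈p : x ∈ p) → h x∈p ≢ z) → ∣ p ∣ < k
∣p∣<-injection {k = k} p h h-inj z h≢z = Fin.injective⇒≤ {f = h′} h′-inj
  where
  h′ : Fin (suc ∣ p ∣) → Fin k
  h′ zero = z
  h′ (suc i) = h (element∈ p i)
  h′-inj : Injective _≡_ _≡_ h′
  h′-inj {zero} {zero} _ = refl
  h′-inj {zero} {suc j} eq = contradiction (sym eq) (h≢z (element∈ p j))
  h′-inj {suc i} {zero} eq = contradiction eq (h≢z (element∈ p i))
  h′-inj {suc i} {suc j} eq = cong suc (element-injective p (h-inj (element∈ p i) (element∈ p j) eq))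

∈-insert⁻ : (p : Subset n) {x y : Fin n} → y ∈ p [ x ]≔ inside → y ≡ x ⊎ y ∈ p
∈-insert⁻ (s ∷ p) {zero} here = inj₁ refl
∈-insert⁻ (s ∷ p) {zero} (there y∈p) = inj₂ (there y∈p)
∈-insert⁻ (s ∷ p) {suc x} here = inj₂ here
∈-insert⁻ (s ∷ p) {suc x} (there y∈) with ∈-insert⁻ p y∈
... | inj₁ y≡x = inj₁ (cong suc y≡x)
... | inj₂ y∈p = inj₂ (there y∈p)

∈-insert⁺ : (p : Subset n) (x : Fin n) {y : Fin n} → y ∈ p → y ∈ p [ x ]≔ inside
∈-insert⁺ p x {y} y∈p with x ≟ y
... | yes refl = Vec.[]≔-updates p x
... | no x≢y = Vec.[]≔-minimal p y x (x≢y ∘ sym) y∈p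

∣insert∣≤ : (p : Subset n) (x : Fin n) → ∣ p [ x ]≔ inside ∣ ≤ suc ∣ p ∣
∣insert∣≤ (true ∷ p) zero = ℕ.n≤1+n _
∣insert∣≤ (false ∷ p) zero = ℕ.≤-refl
∣insert∣≤ (true ∷ p) (suc x) = s≤s (∣insert∣≤ p x)
∣insert∣≤ (false ∷ p) (suc x) = ∣insert∣≤ p x

∣insert∣ : (p : Subset n) {x : Fin n} → x ∉ p → ∣ p [ x ]≔ inside ∣ ≡ suc ∣ p ∣
∣insert∣ (true ∷ p) {zero} x∉p = contradiction here x∉p
∣insert∣ (false ∷ p) {zero} _ = refl
∣insert∣ (true ∷ p) {suc x} x∉p = cong suc (∣insert∣ p (x∉p ∘ there))
∣insert∣ (false ∷ p) {suc x} x∉p = ∣insert∣ p (x∉p ∘ there)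

fromList : List (Fin n) → Subset n
fromList [] = emptySet
fromList (x ∷ xs) = fromList xs [ x ]≔ inside

∈-fromList⁺ : ∀ {x} {xs : List (Fin n)} → x List.∈ xs → x ∈ fromList xs
∈-fromList⁺ {xs = x ∷ xs} (here refl) = Vec.[]≔-updates (fromList xs) x
∈-fromList⁺ {xs = x ∷ xs} (there x∈) = ∈-insert⁺ (fromList xs) x (∈-fromList⁺ x∈)

∈-fromList⁻ : ∀ {x} (xs : List (Fin n)) → x ∈ fromList xs → x List.∈ xs
∈-fromList⁻ [] x∈ = contradiction x∈ ∉⊥
∈-fromList⁻ (y ∷ xs) x∈ with ∈-insert⁻ (fromList xs) x∈
... | inj₁ refl = here refl
... | inj₂ x∈′ = there (∈-fromList⁻ xs x∈′)

∣fromList∣≤ : (xs : List (Fin n)) → ∣ fromList xs ∣ ≤ length xs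
∣fromList∣≤ {n} [] = ℕ.≤-reflexive (∣⊥∣≡0 n)
∣fromList∣≤ (x ∷ xs) = ℕ.≤-trans (∣insert∣≤ (fromList xs) x) (s≤s (∣fromList∣≤ xs))

∣fromList∣ : {xs : List (Fin n)} → Unique xs → ∣ fromList xs ∣ ≡ length xs
∣fromList∣ {n} [] = ∣⊥∣≡0 n
∣fromList∣ {xs = x ∷ xs} (x∉xs ∷ u) = trans
  (∣insert∣ (fromList xs) λ x∈ → All.lookup x∉xs (∈-fromList⁻ xs x∈) refl)
  (cong suc (∣fromList∣ u))

powerset : Subset n → List (Subset n)
powerset [] = [] ∷ []
powerset (true ∷ p) = map (true ∷_) (powerset p) ++ map (false ∷_) (powerset p)
powerset (false ∷ p) = map (false ∷_) (powerset p)

∈-powerset : {p q : Subset n} → q ⊆ p → q List.∈ powerset p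
∈-powerset {p = []} {[]} _ = here refl
∈-powerset {p = true ∷ p} {true ∷ q} q⊆p = ∈-++⁺ˡ (∈-map⁺ _ (∈-powerset (drop-∷-⊆ q⊆p)))
∈-powerset {p = true ∷ p} {false ∷ q} q⊆p = ∈-++⁺ʳ (map (true ∷_) (powerset p)) (∈-map⁺ _ (∈-powerset (drop-∷-⊆ q⊆p)))
∈-powerset {p = false ∷ p} {true ∷ q} q⊆p = case q⊆p here of λ ()
∈-powerset {p = false ∷ p} {false ∷ q} q⊆p = ∈-map⁺ _ (∈-powerset (drop-∷-⊆ q⊆p))

length-powerset : (p : Subset n) → length (powerset p) ≡ 2 ^ ∣ p ∣
length-powerset [] = refl
length-powerset (true ∷ p) = trans (length-++ (map (true ∷_) (powerset p)))
  (cong₂ _+_ (trans (length-map _ (powerset p)) (length-powerset p))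
             (trans (length-map _ (powerset p)) (trans (length-powerset p) (sym (ℕ.+-identityʳ _)))))
length-powerset (false ∷ p) = trans (length-map _ (powerset p)) (length-powerset p)

_≟ˢ_ : (p q : Subset n) → Dec (p ≡ q)
_≟ˢ_ = Vec.≡-dec Bool._≟_

-- A member of `E` that fails is either listed in `used` or a subset of `zs`, and `E` has no
-- duplicates, so at most `length used + 2 ^ length zs` members fail. The embedding takes for `used`
-- the hyperedges already spent and for `zs` the vertices to be avoided.
escape : {E : List (Subset n)} (used : List (Subset n)) (zs : List (Fin n)) → Unique E →
  length used + 2 ^ length zs < length E →
  ∃ λ e → e List.∈ E × ¬ (e List.∈ used) × ∃ λ y → y ∈ e × ¬ (y List.∈ zs)
escape {n} {E} used zs u big with Any.any? (λ e → ¬? (DecMembership._∈?_ _≟ˢ_ e used) ×-dec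
                                  Fin.any? (λ y → (y ∈? e) ×-dec ¬? (DecMembership._∈?_ _≟_ y zs))) E
... | yes p = let e , e∈E , q = List.find p in e , e∈E , q
... | no ¬p = contradiction big (ℕ.≤⇒≯ (ℕ.≤-trans (Unique-⊆⇒length≤ u covered) bound))
  where
  cover : List (Subset n)
  cover = used ++ powerset (fromList zs)
  covered : ∀ {e} → e List.∈ E → e List.∈ cover
  covered {e} e∈E with DecMembership._∈?_ _≟ˢ_ e used
  ... | yes e∈used = ∈-++⁺ˡ e∈used
  ... | no e∉used = ∈-++⁺ʳ used (∈-powerset λ {y} y∈e → ∈-fromList⁺
          (decidable-stable (DecMembership._∈?_ _≟_ y zs)
            λ y∉zs → ¬p (List.lose e∈E (e∉used , y , y∈e , y∉zs))))
  bound : length cover ≤ length used + 2 ^ length zs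
  bound = ℕ.≤-trans (ℕ.≤-reflexive (trans (length-++ used) (cong (length used +_) (length-powerset (fromList zs)))))
    (ℕ.+-monoʳ-≤ (length used) (ℕ.^-monoʳ-≤ 2 (∣fromList∣≤ zs)))

-- Sub-hypergraphs of large minimum degree

degree : List (Subset n) → Fin n → ℕ
degree E x = length (filter (x ∈?_) E)

-- Degrees are counted within `core`, and only at vertices covered by some hyperedge of `core`.
record DenseCore (D : ℕ) (E : List (Subset n)) : Set where
  field
    core     : List (Subset n)
    core⊆    : ∀ {e} → e List.∈ core → e List.∈ E
    core-!   : Unique core
    nonempty : ∃ λ e → e List.∈ core
    dense    : ∀ {e x} → e List.∈ core → x ∈ e → D < degree core x

inhabited : ∀ {d} (xs : List A) → d < length xs → ∃ λ x → x List.∈ xs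
inhabited (x ∷ xs) _ = x , here refl

private
  -- While some vertex of `U` lies on at most `D` hyperedges, it is deleted together with them. Then
  -- `D * ∣ U ∣` falls by at least `D` and the number of hyperedges by at most `D`, so the strict
  -- inequality persists; it also keeps the final list nonempty. The recursion is on the bound `h`
  -- for `∣ U ∣`.
  prune : ∀ (D h : ℕ) (U : Subset n) → ∣ U ∣ ≤ h → (E : List (Subset n)) → Unique E →
    (∀ {e x} → e List.∈ E → x ∈ e → x ∈ U) → D * ∣ U ∣ < length E → DenseCore D E
  prune D h U ∣U∣≤h E E-! E⊆U big with Fin.any? (λ x → (x ∈? U) ×-dec (degree E x ≤? D))
  ... | no ¬low = record
    { core = E ; core⊆ = λ e∈ → e∈ ; core-! = E-! ; nonempty = inhabited E big
    ; dense = λ {e} {x} e∈E x∈e → ℕ.≰⇒> λ low → ¬low (x , E⊆U e∈E x∈e , low) }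
  prune D zero U ∣U∣≤h E E-! E⊆U big | yes (x , x∈U , low) =
    contradiction (ℕ.<-≤-trans (x∈p⇒∣p-x∣<∣p∣ x∈U) ∣U∣≤h) λ ()
  prune D (suc h) U ∣U∣≤h E E-! E⊆U big | yes (x , x∈U , low) = record
    { core = core ; core⊆ = λ e∈ → proj₁ (∈-filter⁻ avoids? {xs = E} (core⊆ e∈))
    ; core-! = core-! ; nonempty = nonempty ; dense = dense }
    where
    avoids? = λ e → ¬? (x ∈? e)
    E′ = filter avoids? E
    ∣U-x∣<∣U∣ = x∈p⇒∣p-x∣<∣p∣ x∈U
    big′ : D * ∣ U - x ∣ < length E′
    big′ = ℕ.+-cancelˡ-< D _ _ (begin-strict
      D + D * ∣ U - x ∣          ≡⟨ ℕ.*-suc D _ ⟨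
      D * suc ∣ U - x ∣          ≤⟨ ℕ.*-monoʳ-≤ D ∣U-x∣<∣U∣ ⟩
      D * ∣ U ∣                  <⟨ big ⟩
      length E                   ≡⟨ length-filter-∁ (x ∈?_) E ⟩
      degree E x + length E′     ≤⟨ ℕ.+-monoˡ-≤ _ low ⟩
      D + length E′ ∎)
      where open ℕ.≤-Reasoning
    E′⊆ : ∀ {e y} → e List.∈ E′ → y ∈ e → y ∈ U - x
    E′⊆ e∈E′ y∈e with ∈-filter⁻ avoids? {xs = E} e∈E′
    ... | e∈E , x∉e = x∈p∧x≢y⇒x∈p-y (E⊆U e∈E y∈e) λ { refl → x∉e y∈e }
    open DenseCore (prune D h (U - x) (s≤s⁻¹ (ℕ.≤-trans ∣U-x∣<∣U∣ ∣U∣≤h)) E′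
                      (Unique.filter⁺ avoids? E-!) E′⊆ big′)

denseCore : ∀ (D : ℕ) {E : List (Subset n)} → Unique E → D * n < length E → DenseCore D E
denseCore {n} D {E} E-! big = prune D n ⊤ (ℕ.≤-reflexive (∣⊤∣≡n n)) E E-! (λ _ _ → ∈⊤)
  (subst (λ z → D * z < length E) (sym (∣⊤∣≡n n)) big)

-- Berge copies and the decidability of containing one

anyFunction? : {P : (Fin m → Fin n) → Set} → (∀ {f g} → f ≗ g → P f → P g) → Decidable P → Dec (∃ P)
anyFunction? {zero} resp P? = map′ (_ ,_) (λ (f , p) → resp (λ ()) p) (P? λ ())
anyFunction? {suc m} resp P? = map′
  (λ (x , f , p) → _ , p)
  -- The function rebuilt from head and tail agrees with `f` only pointwise, hence the appeal to
  -- `resp`.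
  (λ (f , p) → head f , tail f , resp (λ { zero → refl ; (suc _) → refl }) p)
  (Fin.any? λ x → anyFunction? (λ f≗g → resp λ { zero → refl ; (suc i) → f≗g i }) (λ f → P? (x Vector.∷ f)))

injective? : Decidable {A = Fin m → Fin n} (Injective _≡_ _≡_)
injective? f = map′ (λ inj {x} {y} → inj x y) (λ inj x y → inj)
  (Fin.all? λ x → Fin.all? λ y → (f x ≟ f y) →-dec (x ≟ y))

injective-resp-≗ : {f g : Fin m → Fin n} → f ≗ g → Injective _≡_ _≡_ f → Injective _≡_ _≡_ g
injective-resp-≗ f≗g inj eq = inj (trans (f≗g _) (trans eq (sym (f≗g _))))

size : Graph m → ℕ
size F = length (edges F)

source target : (F : Graph m) → Fin (size F) → Fin m
source F i = proj₁ (lookup (edges F) i)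
target F i = proj₂ (lookup (edges F) i)

containsBerge? : (F : Graph m) (E : List (Subset n)) → Dec (ContainsBerge F E)
containsBerge? F E = anyFunction?
  (λ ψ≗ψ′ (ψ-inj , φ , φ-inj , c) → injective-resp-≗ ψ≗ψ′ ψ-inj , φ , φ-inj , λ i →
    subst (_∈ lookup E (φ i)) (ψ≗ψ′ _) (proj₁ (c i)) , subst (_∈ lookup E (φ i)) (ψ≗ψ′ _) (proj₂ (c i)))
  λ ψ → injective? ψ ×-dec anyFunction?
    (λ φ≗φ′ (φ-inj , c) → injective-resp-≗ φ≗φ′ φ-inj , λ i →
      subst (λ j → ψ (source F i) ∈ lookup E j × ψ (target F i) ∈ lookup E j) (φ≗φ′ i) (c i))
    λ φ → injective? φ ×-dec Fin.all? λ i → (ψ (source F i) ∈? lookup E (φ i)) ×-dec (ψ (target F i) ∈? lookup E (φ i))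

-- For a duplicate-free E this is ContainsBerge with hyperedges in place of their positions in E.
record BergeCopy (F : Graph m) (E : List (Subset n)) : Set where
  field
    vertex           : Fin m → Fin n
    vertex-injective : Injective _≡_ _≡_ vertex
    edge             : Fin (size F) → Subset n
    edge-injective   : Injective _≡_ _≡_ edge
    edge∈            : ∀ i → edge i List.∈ E
    source∈          : ∀ i → vertex (source F i) ∈ edge i
    target∈          : ∀ i → vertex (target F i) ∈ edge i

module _ (F : Graph m) {E : List (Subset n)} where

  containsBerge⁺ : BergeCopy F E → ContainsBerge F E
  containsBerge⁺ C = vertex , vertex-injective , (λ i → index (edge∈ i)) ,
    (λ eq → edge-injective (index-injective (edge∈ _) (edge∈ _) eq)) ,
    λ i → subst (_ ∈_) (lookup-index (edge∈ i)) (source∈ i) , subst (_ ∈_) (lookup-index (edge∈ i)) (target∈ i)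
    where open BergeCopy C

  containsBerge⁻ : Unique E → ContainsBerge F E → BergeCopy F E
  containsBerge⁻ E-! (ψ , ψ-inj , φ , φ-inj , c) = record
    { vertex = ψ ; vertex-injective = ψ-inj
    ; edge = lookup E ∘ φ ; edge-injective = φ-inj ∘ lookup-injective E-!
    ; edge∈ = λ i → ∈-lookup (φ i) ; source∈ = proj₁ ∘ c ; target∈ = proj₂ ∘ c }

-- Positions in the two lists need not correspond, so the copy is carried over by its hyperedges.
containsBerge-mono : (F : Graph m) {E E′ : List (Subset n)} → Unique E → (∀ {e} → e List.∈ E → e List.∈ E′) →
  ContainsBerge F E → ContainsBerge F E′
containsBerge-mono F E-! E⊆E′ c = containsBerge⁺ F record
  { vertex = vertex ; vertex-injective = vertex-injective ; edge = edge ; edge-injective = edge-injective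
  ; edge∈ = E⊆E′ ∘ edge∈ ; source∈ = source∈ ; target∈ = target∈ }
  where open BergeCopy (containsBerge⁻ F E-! c)

-- Greedy extension to a saturated hypergraph

record Extension (F : Graph m) (H : UHypergraph k n) (es : List (Subset n)) : Set where
  field
    ext       : UHypergraph k n
    ext⊇      : ∀ {e} → e List.∈ hedges H → e List.∈ hedges ext
    free      : ¬ ContainsBerge F (hedges ext)
    saturated : ∀ {e} → e List.∈ es → ∣ e ∣ ≡ k → ¬ (e List.∈ hedges ext) → ContainsBerge F (e ∷ hedges ext)

-- Each new candidate of the right size is added at once unless it completes a Berge copy of `F`.
-- Once all `k`-sets have been candidates, the result is saturated.
extend : (F : Graph m) (H : UHypergraph k n) → ¬ ContainsBerge F (hedges H) →
  (es : List (Subset n)) → Extension F H es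
extend F H H-free [] = record { ext = H ; ext⊇ = λ e∈ → e∈ ; free = H-free ; saturated = λ () }
extend {k = k} F H H-free (e ∷ es)
  with ∣ e ∣ ℕ.≟ k | DecMembership._∈?_ _≟ˢ_ e (hedges H) | containsBerge? F (e ∷ hedges H)
... | no ∣e∣≢k | _ | _ = record
  { ext = ext ; ext⊇ = ext⊇ ; free = free
  ; saturated = λ { (here refl) ∣e∣≡k _ → contradiction ∣e∣≡k ∣e∣≢k ; (there e∈) → saturated e∈ } }
  where open Extension (extend F H H-free es)
... | yes _ | yes e∈H | _ = record
  { ext = ext ; ext⊇ = ext⊇ ; free = free
  ; saturated = λ { (here refl) _ e∉ → contradiction (ext⊇ e∈H) e∉ ; (there e∈) → saturated e∈ } }
  where open Extension (extend F H H-free es)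
... | yes _ | no e∉H | yes c = record
  { ext = ext ; ext⊇ = ext⊇ ; free = free
  -- The copy that caused the rejection of `e` survives all later additions.
  ; saturated = λ { (here refl) _ _ → containsBerge-mono F e∷H-! (λ { (here p) → here p ; (there p) → there (ext⊇ p) }) c
                  ; (there e∈) → saturated e∈ } }
  where
  open Extension (extend F H H-free es)
  e∷H-! : Unique (e ∷ hedges H)
  e∷H-! = All.tabulate (λ { x∈ refl → e∉H x∈ }) ∷ hunique H
... | yes ∣e∣≡k | no e∉H | no ¬c = record
  { ext = ext ; ext⊇ = ext⊇ ∘ there ; free = free
  ; saturated = λ { (here refl) _ e∉ → contradiction (ext⊇ (here refl)) e∉ ; (there e∈) → saturated e∈ } }
  where
  H′ : UHypergraph k _
  H′ = record { hedges = e ∷ hedges H ; uniform = ∣e∣≡k ∷ uniform H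
              ; hunique = All.tabulate (λ { x∈ refl → e∉H x∈ }) ∷ hunique H }
  open Extension (extend F H′ ¬c es)

-- Edges of a simple graph and leaves of an induced forest

module _ (F : Graph m) where

  source<target : ∀ i → toℕ (source F i) < toℕ (target F i)
  source<target i = All.lookup (ordered F) (∈-lookup i)

  adj-irrefl : ∀ {u v} → Adj F u v → u ≢ v
  adj-irrefl (inj₁ p) refl = ℕ.<-irrefl refl (All.lookup (ordered F) p)
  adj-irrefl (inj₂ p) refl = ℕ.<-irrefl refl (All.lookup (ordered F) p)

  adj-sym : ∀ {u v} → Adj F u v → Adj F v u
  adj-sym (inj₁ p) = inj₂ p
  adj-sym (inj₂ p) = inj₁ p

  adj? : ∀ u v → Dec (Adj F u v)
  adj? u v = ((u , v) ∈ₑ? edges F) ⊎-dec ((v , u) ∈ₑ? edges F)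
    where
    _∈ₑ?_ = DecMembership._∈?_ (≡-dec _≟_ _≟_)

  edge-adj : ∀ i → Adj F (source F i) (target F i)
  edge-adj i = inj₁ (∈-lookup i)

  Ends : Fin (size F) → Fin m → Fin m → Set
  Ends i u v = (source F i ≡ u × target F i ≡ v) ⊎ (source F i ≡ v × target F i ≡ u)

  adj-edge : ∀ {u v} → Adj F u v → ∃ λ i → Ends i u v
  adj-edge (inj₁ p) = index p , inj₁ (cong proj₁ (sym (lookup-index p)) , cong proj₂ (sym (lookup-index p)))
  adj-edge (inj₂ p) = index p , inj₂ (cong proj₁ (sym (lookup-index p)) , cong proj₂ (sym (lookup-index p)))

  Ends-swap : ∀ {i u v} → Ends i u v → Ends i v u
  Ends-swap (inj₁ p) = inj₂ p
  Ends-swap (inj₂ p) = inj₁ p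

  Ends-adj : ∀ {i u v} → Ends i u v → Adj F u v
  Ends-adj {i} (inj₁ (refl , refl)) = edge-adj i
  Ends-adj {i} (inj₂ (refl , refl)) = adj-sym (edge-adj i)

  -- With equal orientations this is the absence of duplicates among the edges. Opposite
  -- orientations are impossible, since each edge is stored with its smaller end first.
  Ends-unique : ∀ {i j u v} → Ends i u v → Ends j u v → i ≡ j
  Ends-unique (inj₁ (p , q)) (inj₁ (p′ , q′)) =
    lookup-injective (unique F) (cong₂ _,_ (trans p (sym p′)) (trans q (sym q′)))
  Ends-unique (inj₂ (p , q)) (inj₂ (p′ , q′)) =
    lookup-injective (unique F) (cong₂ _,_ (trans p (sym p′)) (trans q (sym q′)))
  Ends-unique {i} {j} (inj₁ (refl , refl)) (inj₂ (p′ , q′)) =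
    contradiction (subst₂ _<_ (cong toℕ p′) (cong toℕ q′) (source<target j)) (ℕ.<-asym (source<target i))
  Ends-unique {i} {j} (inj₂ (refl , refl)) (inj₁ (p′ , q′)) =
    contradiction (subst₂ _<_ (cong toℕ p′) (cong toℕ q′) (source<target j)) (ℕ.<-asym (source<target i))

  Ends-determined : ∀ {i u v u′ v′} → Ends i u v → Ends i u′ v′ → (u ≡ u′ × v ≡ v′) ⊎ (u ≡ v′ × v ≡ u′)
  Ends-determined (inj₁ (refl , refl)) (inj₁ q) = inj₁ q
  Ends-determined (inj₁ (refl , refl)) (inj₂ q) = inj₂ q
  Ends-determined (inj₂ (refl , refl)) (inj₁ (p , q)) = inj₂ (q , p)
  Ends-determined (inj₂ (refl , refl)) (inj₂ (p , q)) = inj₁ (q , p)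

  module _ (A W : Subset m) (A∩W=∅ : ∀ {u} → u ∈ A → u ∉ W) (acyclic : AcyclicAfterDeleting F W) where

    HasTwoNeighbours : Fin m → Set
    HasTwoNeighbours v = ∃ λ u → ∃ λ u′ → u ∈ A × u′ ∈ A × Adj F v u × Adj F v u′ × u ≢ u′

    hasTwoNeighbours? : ∀ v → Dec (HasTwoNeighbours v)
    hasTwoNeighbours? v = Fin.any? λ u → Fin.any? λ u′ →
      (u ∈? A) ×-dec (u′ ∈? A) ×-dec adj? v u ×-dec adj? v u′ ×-dec ¬? (u ≟ u′)

    -- A path is listed from its newest vertex back to its oldest one; a chord from the newest
    -- vertex closes a cycle, so by finiteness the path cannot be prolonged for ever.
    module _ (two : ∀ {v} → v ∈ A → HasTwoNeighbours v) where

      prolong : ∀ h {l} (p : Fin (2 + l) → Fin m) → Injective _≡_ _≡_ p → (∀ i → p i ∈ A) →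
        (∀ {i j} → toℕ j ≡ suc (toℕ i) → Adj F (p i) (p j)) → m < h + (2 + l) → ⊥
      -- The fuel is exhausted only when the path would have more than `m` distinct vertices.
      prolong zero p p-inj _ _ m< = ℕ.<⇒≱ m< (Fin.injective⇒≤ p-inj)
      prolong (suc h) {l} p p-inj p∈A p-adj m<
        with two (p∈A zero)
      -- Of two distinct neighbours, at least one is not the predecessor `p (suc zero)`.
      ... | u , u′ , u∈A , u′∈A , a , a′ , u≢u′ = go (case u ≟ p (suc zero) of λ where
              (yes refl) → u′ , u′∈A , a′ , u≢u′ ∘ sym
              (no u≢p₁) → u , u∈A , a , u≢p₁)
        where
        go : (∃ λ y → y ∈ A × Adj F (p zero) y × y ≢ p (suc zero)) → ⊥
        go (y , y∈A , adj , y≢p₁) with Fin.any? (λ j → p j ≟ y)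
        ... | yes (zero , refl) = adj-irrefl adj refl
        ... | yes (suc zero , refl) = y≢p₁ refl
        -- The neighbour sits at position `2 + j`, so positions 0 to `2 + j` form a cycle of length
        -- `3 + j`.
        ... | yes (suc (suc j) , refl) = acyclic _
          (toℕ j , refl , c , (λ {i} {i′} eq → Fin.inject≤-injective le le i i′ (p-inj eq)) ,
            (λ i → p-adj (trans (Fin.toℕ-inject≤ (suc i) le)
                     (cong suc (sym (trans (Fin.toℕ-inject≤ (inject₁ i) le) (Fin.toℕ-inject₁ i)))))) ,
            subst (λ x → Adj F x (p zero)) (cong p (Fin.toℕ-injective (sym last))) (adj-sym adj) ,
            λ i → A∩W=∅ (p∈A _))
          where
          le : 3 + toℕ j ≤ 2 + l
          le = s≤s (s≤s (Fin.toℕ<n j))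
          c : Fin (3 + toℕ j) → Fin m
          c i = p (inject≤ i le)
          last : toℕ (inject≤ (fromℕ (2 + toℕ j)) le) ≡ 2 + toℕ j
          last = trans (Fin.toℕ-inject≤ (fromℕ (2 + toℕ j)) le) (Fin.toℕ-fromℕ _)
        ... | no y∉p = prolong h p′ p′-inj (λ { zero → y∈A ; (suc i) → p∈A i }) p′-adj
                         (subst (m <_) (sym (ℕ.+-suc h (2 + l))) m<)
          where
          p′ : Fin (3 + l) → Fin m
          p′ = y Vector.∷ p
          p′-inj : Injective _≡_ _≡_ p′
          p′-inj {zero} {zero} _ = refl
          p′-inj {zero} {suc j} eq = contradiction (j , sym eq) y∉p
          p′-inj {suc i} {zero} eq = contradiction (i , eq) y∉p
          p′-inj {suc i} {suc j} eq = cong suc (p-inj eq)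
          p′-adj : ∀ {i j} → toℕ j ≡ suc (toℕ i) → Adj F (p′ i) (p′ j)
          p′-adj {zero} {suc zero} _ = adj-sym adj
          p′-adj {suc i} {suc j} eq = p-adj (ℕ.suc-injective eq)

      no-min-degree-two : ∀ {v} → v ∈ A → ⊥
      no-min-degree-two {v} v∈A with two v∈A
      ... | u , _ , u∈A , _ , a , _ = prolong m p p-inj (λ { zero → u∈A ; (suc zero) → v∈A }) p-adj (ℕ.m<m+n m (s≤s z≤n))
        where
        p : Fin 2 → Fin m
        p zero = u
        p (suc zero) = v
        p-inj : Injective _≡_ _≡_ p
        p-inj {zero} {zero} _ = refl
        p-inj {zero} {suc zero} eq = contradiction (sym eq) (adj-irrefl a)
        p-inj {suc zero} {zero} eq = contradiction eq (adj-irrefl a)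
        p-inj {suc zero} {suc zero} _ = refl
        p-adj : ∀ {i j} → toℕ j ≡ suc (toℕ i) → Adj F (p i) (p j)
        p-adj {zero} {suc zero} _ = adj-sym a
        p-adj {suc zero} {suc zero} ()

    -- If every vertex of `A` had two neighbours in `A`, a path in `A` could be prolonged until it
    -- closed a cycle avoiding `W`. A vertex without neighbours in `A` also counts as a leaf.
    leaf : ∀ {v} → v ∈ A → ∃ λ v → v ∈ A × (∀ {u u′} → u ∈ A → u′ ∈ A → Adj F v u → Adj F v u′ → u ≡ u′)
    leaf v∈A with Fin.any? (λ v → (v ∈? A) ×-dec ¬? (hasTwoNeighbours? v))
    ... | yes (v , v∈A , ¬two) = v , v∈A , λ {u} {u′} u∈A u′∈A a a′ →
      decidable-stable (u ≟ u′) λ u≢u′ → ¬two (u , u′ , u∈A , u′∈A , a , a′ , u≢u′)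
    ... | no ¬leaf = ⊥-elim (no-min-degree-two
      (λ {v} v∈A → decidable-stable (hasTwoNeighbours? v) λ ¬two → ¬leaf (v , v∈A , ¬two)) v∈A)

-- The cyclic order of positions on a cycle

Next : Fin (suc n) → Fin (suc n) → Set
Next {n} i j = toℕ j ≡ suc (toℕ i) ⊎ (toℕ i ≡ n × j ≡ zero)

next : (i : Fin (suc n)) → ∃ (Next i)
next {n} i with toℕ i ℕ.≟ n
... | yes i≡n = zero , inj₂ (i≡n , refl)
... | no i≢n = fromℕ< i<n , inj₁ (Fin.toℕ-fromℕ< i<n)
  where
  i<n : suc (toℕ i) < suc n
  i<n = s≤s (ℕ.≤∧≢⇒< (s≤s⁻¹ (Fin.toℕ<n i)) i≢n)

Next-functional : {i j j′ : Fin (suc n)} → Next i j → Next i j′ → j ≡ j′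
Next-functional (inj₁ p) (inj₁ q) = Fin.toℕ-injective (trans p (sym q))
Next-functional (inj₂ (_ , refl)) (inj₂ (_ , refl)) = refl
Next-functional {j = j} (inj₁ p) (inj₂ (q , _)) = contradiction (Fin.toℕ<n j) (ℕ.<-irrefl (trans p (cong suc q)))
Next-functional {j′ = j′} (inj₂ (q , _)) (inj₁ p) = contradiction (Fin.toℕ<n j′) (ℕ.<-irrefl (trans p (cong suc q)))

-- Three positions are essential: on two, each succeeds the other. This is what stops a cycle from
-- traversing one edge in both directions.
Next-asym : {i j : Fin (3 + n)} → Next i j → ¬ Next j i
Next-asym {i = i} (inj₁ p) (inj₁ q) = ℕ.m≢1+m+n (toℕ i) (trans (trans q (cong suc p)) (cong suc (ℕ.+-comm 1 _)))
Next-asym (inj₁ p) (inj₂ (q , refl)) = case trans (sym q) p of λ ()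
Next-asym (inj₂ (p , refl)) (inj₁ q) = case trans (sym p) q of λ ()
Next-asym (inj₂ (p , refl)) (inj₂ (() , _))

-- A circle cut at a single point is still connected. If no exceptional position lies between 1 and
-- `i`, walk from 0 up to `i`; otherwise the only one is already behind, and the walk goes from `i`
-- up to `n` and wraps round to 0.
cyclic-constant : {β : Fin (suc n) → A} {Q : Fin (suc n) → Set} → Decidable Q →
  (∀ {i j} → Q i → Q j → i ≡ j) → (∀ {i j} → Next i j → ¬ Q j → β i ≡ β j) → ∀ i → β i ≡ β zero
cyclic-constant {n} {β = β} {Q} Q? Q-unique step i
  with Fin.any? (λ j → (0 <? toℕ j) ×-dec (toℕ j ≤? toℕ i) ×-dec Q? j)
... | no none = up i (λ j 0<j j≤i Qj → none (j , 0<j , j≤i , Qj))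
  where
  up : ∀ i → (∀ j → 0 < toℕ j → toℕ j ≤ toℕ i → ¬ Q j) → β i ≡ β zero
  up = <-weakInduction _ (λ _ → refl) λ i ih none → trans
    (sym (step (inj₁ (cong suc (sym (Fin.toℕ-inject₁ i)))) (none (suc i) (s≤s z≤n) ℕ.≤-refl)))
    (ih λ j 0<j j≤i → none j 0<j (ℕ.m≤n⇒m≤1+n (subst (toℕ j ≤_) (Fin.toℕ-inject₁ i) j≤i)))
... | yes (j , 0<j , j≤i , Qj) = trans
  (down i λ j′ i<j′ Qj′ → ℕ.<⇒≢ (ℕ.≤-<-trans j≤i i<j′) (cong toℕ (Q-unique Qj Qj′)))
  (step (inj₂ (Fin.toℕ-fromℕ n , refl)) λ Q₀ → ℕ.<⇒≢ 0<j (cong toℕ (Q-unique Q₀ Qj)))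
  where
  down : ∀ i → (∀ j → toℕ i < toℕ j → ¬ Q j) → β i ≡ β (fromℕ n)
  down = >-weakInduction _ (λ _ → refl) λ i ih none → trans
    (step (inj₁ (cong suc (sym (Fin.toℕ-inject₁ i)))) (none (suc i) (s≤s (ℕ.≤-reflexive (Fin.toℕ-inject₁ i)))))
    (ih λ j i<j → none j (ℕ.≤-<-trans (ℕ.≤-reflexive (Fin.toℕ-inject₁ i)) (ℕ.<-trans ℕ.≤-refl i<j)))

module _ (F : Graph m) {S : Subset m} where

  cycle-adj : ∀ {r} (c : Fin (3 + r) → Fin m) → (∀ i → Adj F (c (inject₁ i)) (c (suc i))) →
    Adj F (c (fromℕ (2 + r))) (c zero) → ∀ {i j} → Next i j → Adj F (c i) (c j)
  cycle-adj c path close {i} {suc j} (inj₁ p) = subst (λ x → Adj F (c x) (c (suc j)))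
    (Fin.toℕ-injective (trans (Fin.toℕ-inject₁ j) (ℕ.suc-injective p))) (path j)
  cycle-adj {r} c path close (inj₂ (p , refl)) = subst (λ x → Adj F (c x) (c zero))
    (Fin.toℕ-injective (trans (Fin.toℕ-fromℕ (2 + r)) (sym p))) close

  -- A shared edge has the same two ends, in the same or in reversed order. The first case gives
  -- equal positions by injectivity; the second makes two positions succeed each other.
  cycle-edges-distinct : ∀ {r} (c : Fin (3 + r) → Fin m) → Injective _≡_ _≡_ c →
    ∀ {a i i′ j j′} → Next i i′ → Next j j′ →
    Ends F a (c i) (c i′) → Ends F a (c j) (c j′) → i ≡ j
  cycle-edges-distinct c c-inj i→i′ j→j′ ends ends′ with Ends-determined F ends ends′
  ... | inj₁ (p , _) = c-inj p
  ... | inj₂ (p , q) with refl ← c-inj p | refl ← c-inj q = contradiction j→j′ (Next-asym i→i′)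

-- The base hypergraph and why it is Berge-free

module Construction (f κ q r : ℕ) where

  -- The block size k - 1 for uniformity k = `3 + κ`, so that one centre and one full block make a
  -- hyperedge.
  w : ℕ
  w = 2 + κ

  -- Room for the centres, a block for each ordered pair of centres, the star blocks, and a
  -- remainder of spare vertices lying in no base hyperedge.
  order : ℕ
  order = f + (f * f * w + (q * w + r))

  data Block : Set where
    pairBlock : Fin f → Fin f → Block
    starBlock : Fin q → Block

  data Vertex : Set where
    centre : Fin f → Vertex
    cell   : Block → Fin w → Vertex
    spare  : Fin r → Vertex

  encode : Vertex → Fin order
  encode (centre i) = i ↑ˡ _
  encode (cell (pairBlock i j) t) = f ↑ʳ (combine (combine i j) t ↑ˡ _)
  encode (cell (starBlock b) t) = f ↑ʳ (f * f * w ↑ʳ (combine b t ↑ˡ r))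
  encode (spare x) = f ↑ʳ (f * f * w ↑ʳ (q * w ↑ʳ x))

  pairCell : Fin (f * f) × Fin w → Vertex
  pairCell (ij , t) = cell (pairBlock (proj₁ (remQuot {f} f ij)) (proj₂ (remQuot {f} f ij))) t

  starCell : Fin q × Fin w → Vertex
  starCell (b , t) = cell (starBlock b) t

  decode₂ : Fin (q * w + r) → Vertex
  decode₂ = [ starCell ∘ remQuot {q} w , spare ]′ ∘ splitAt (q * w)

  decode₁ : Fin (f * f * w + (q * w + r)) → Vertex
  decode₁ = [ pairCell ∘ remQuot {f * f} w , decode₂ ]′ ∘ splitAt (f * f * w)

  decode : Fin order → Vertex
  decode = [ centre , decode₁ ]′ ∘ splitAt f

  decode-encode : ∀ v → decode (encode v) ≡ v
  decode-encode (centre i) rewrite Fin.splitAt-↑ˡ f i (f * f * w + (q * w + r)) = refl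
  decode-encode (cell (pairBlock i j) t)
    rewrite Fin.splitAt-↑ʳ f (f * f * w + (q * w + r)) (combine (combine i j) t ↑ˡ (q * w + r))
          | Fin.splitAt-↑ˡ (f * f * w) (combine (combine i j) t) (q * w + r)
    = trans (cong pairCell (Fin.remQuot-combine (combine i j) t))
            (cong (λ ij → cell (pairBlock (proj₁ ij) (proj₂ ij)) t) (Fin.remQuot-combine i j))
  decode-encode (cell (starBlock b) t)
    rewrite Fin.splitAt-↑ʳ f (f * f * w + (q * w + r)) (f * f * w ↑ʳ (combine b t ↑ˡ r))
          | Fin.splitAt-↑ʳ (f * f * w) (q * w + r) (combine b t ↑ˡ r)
          | Fin.splitAt-↑ˡ (q * w) (combine b t) r
    = cong starCell (Fin.remQuot-combine b t)
  decode-encode (spare x)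
    rewrite Fin.splitAt-↑ʳ f (f * f * w + (q * w + r)) (f * f * w ↑ʳ (q * w ↑ʳ x))
          | Fin.splitAt-↑ʳ (f * f * w) (q * w + r) (q * w ↑ʳ x)
          | Fin.splitAt-↑ʳ (q * w) r x = refl

  encode-pairCell : ∀ p → encode (pairCell p) ≡ f ↑ʳ (combine (proj₁ p) (proj₂ p) ↑ˡ _)
  encode-pairCell (ij , t) = cong (λ s → f ↑ʳ (combine {f * f} s t ↑ˡ _)) (Fin.combine-remQuot {f} f ij)

  encode-decode : ∀ x → encode (decode x) ≡ x
  encode-decode x with splitAt f x in eq
  ... | inj₁ i = Fin.splitAt⁻¹-↑ˡ eq
  ... | inj₂ y with splitAt (f * f * w) y in eq′
  ... | inj₁ z = trans (encode-pairCell (remQuot {f * f} w z))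
    (trans (cong (λ s → f ↑ʳ (s ↑ˡ _)) (Fin.combine-remQuot {f * f} w z))
    (trans (cong (f ↑ʳ_) (Fin.splitAt⁻¹-↑ˡ eq′)) (Fin.splitAt⁻¹-↑ʳ eq)))
  ... | inj₂ z with splitAt (q * w) z in eq″
  ... | inj₁ bt = trans
    (cong (λ s → f ↑ʳ (f * f * w ↑ʳ (s ↑ˡ r))) (Fin.combine-remQuot {q} w bt))
    (trans (cong (λ s → f ↑ʳ (f * f * w ↑ʳ s)) (Fin.splitAt⁻¹-↑ˡ eq″))
    (trans (cong (f ↑ʳ_) (Fin.splitAt⁻¹-↑ʳ eq′)) (Fin.splitAt⁻¹-↑ʳ eq)))
  ... | inj₂ s = trans (cong (λ s → f ↑ʳ (f * f * w ↑ʳ s)) (Fin.splitAt⁻¹-↑ʳ eq″))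
    (trans (cong (f ↑ʳ_) (Fin.splitAt⁻¹-↑ʳ eq′)) (Fin.splitAt⁻¹-↑ʳ eq))

  encode-injective : Injective _≡_ _≡_ encode
  encode-injective eq = trans (sym (decode-encode _)) (trans (cong decode eq) (decode-encode _))

  decode-injective : Injective _≡_ _≡_ decode
  decode-injective eq = trans (sym (encode-decode _)) (trans (cong encode eq) (encode-decode _))

  data Spoke : Set where
    star : Fin q → Fin f → Spoke
    pair : Fin f → Fin f → Spoke

  block : Spoke → Block
  block (star b i) = starBlock b
  block (pair i j) = pairBlock i j

  centreOf : Spoke → Fin f
  centreOf (star b i) = i
  centreOf (pair i j) = i

  -- Consequently hyperedges on one block inject into the `f` centres, which is the count to be
  -- compared with the girth.
  block-centre-injective : ∀ {d d′} → block d ≡ block d′ → centreOf d ≡ centreOf d′ → d ≡ d′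
  block-centre-injective {star b i} {star b′ i′} refl refl = refl
  block-centre-injective {pair i j} {pair i′ j′} refl _ = refl

  -- The cell 0 of a pair block is left out, as such a hyperedge has two centres.
  vertices : Spoke → List Vertex
  vertices (star b i) = centre i ∷ tabulate (cell (starBlock b))
  vertices (pair i j) = centre i ∷ centre j ∷ tabulate (cell (pairBlock i j) ∘ suc)

  hyperedge : Spoke → Subset order
  hyperedge d = fromList (map encode (vertices d))

  ∈-hyperedge⁺ : ∀ {v d} → v List.∈ vertices d → encode v ∈ hyperedge d
  ∈-hyperedge⁺ v∈ = ∈-fromList⁺ (∈-map⁺ encode v∈)

  ∈-hyperedge⁻ : ∀ {x d} → x ∈ hyperedge d → decode x List.∈ vertices d
  ∈-hyperedge⁻ {d = d} x∈ with ∈-map⁻ encode (∈-fromList⁻ (map encode (vertices d)) x∈)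
  ... | v , v∈ , refl = subst (List._∈ vertices d) (sym (decode-encode v)) v∈

  module _ {l} (B : Block) (g : Fin l → Fin w) where

    ∈-cells⁻ : ∀ {v} → v List.∈ tabulate (cell B ∘ g) → ∃ λ t → v ≡ cell B (g t)
    ∈-cells⁻ = ∈-tabulate⁻ {f = cell B ∘ g}

    centre∉cells : ∀ {i} → ¬ (centre i List.∈ tabulate (cell B ∘ g))
    centre∉cells p = case ∈-cells⁻ p of λ ()

    spare∉cells : ∀ {x} → ¬ (spare x List.∈ tabulate (cell B ∘ g))
    spare∉cells p = case ∈-cells⁻ p of λ ()

    cells-unique : Injective _≡_ _≡_ g → Unique (tabulate (cell B ∘ g))
    cells-unique g-inj = Unique.tabulate⁺ λ eq → g-inj (cell-injective eq)
      where
      cell-injective : ∀ {t t′} → cell B t ≡ cell B t′ → t ≡ t′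
      cell-injective refl = refl

  cell∈⇒block : ∀ {B t d} → cell B t List.∈ vertices d → B ≡ block d
  cell∈⇒block {d = star b i} (there p) with ∈-cells⁻ (starBlock b) id p
  ... | _ , refl = refl
  cell∈⇒block {d = pair i j} (there (there p)) with ∈-cells⁻ (pairBlock i j) suc p
  ... | _ , refl = refl

  spare∉ : ∀ {x d} → ¬ (spare x List.∈ vertices d)
  spare∉ {d = star b i} (there p) = spare∉cells (starBlock b) id p
  spare∉ {d = pair i j} (there (there p)) = spare∉cells (pairBlock i j) suc p

  -- Unlike cell 0, cell 1 belongs to both kinds of spoke; it exists because blocks have at least
  -- two cells. It lets a hyperedge reveal its block.
  cell₁∈ : ∀ d → cell (block d) (suc zero) List.∈ vertices d
  cell₁∈ (star b i) = there (∈-tabulate⁺ {f = cell (starBlock b)} (suc zero))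
  cell₁∈ (pair i j) = there (there (∈-tabulate⁺ {f = cell (pairBlock i j) ∘ suc} zero))

  vertices-cong : ∀ {v} d d′ → hyperedge d ≡ hyperedge d′ → v List.∈ vertices d → v List.∈ vertices d′
  vertices-cong {v} d d′ eq v∈ = subst (List._∈ vertices d′) (decode-encode v)
    (∈-hyperedge⁻ {d = d′} (subst (encode v ∈_) eq (∈-hyperedge⁺ {d = d} v∈)))

  hyperedge-block : ∀ d d′ → hyperedge d ≡ hyperedge d′ → block d ≡ block d′
  hyperedge-block d d′ eq = cell∈⇒block {d = d′} (vertices-cong d d′ eq (cell₁∈ d))

  -- Once the block is known, only two stars remain to be told apart, and a star contains a single
  -- centre.
  hyperedge-injective : Injective _≡_ _≡_ hyperedge
  hyperedge-injective {d@(star b i)} {d′@(star b′ i′)} eq with hyperedge-block d d′ eq | vertices-cong d d′ eq (here refl)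
  ... | refl | here refl = refl
  ... | refl | there p = contradiction p (centre∉cells (starBlock b) id)
  hyperedge-injective {d@(star _ _)} {d′@(pair _ _)} eq = case hyperedge-block d d′ eq of λ ()
  hyperedge-injective {d@(pair _ _)} {d′@(star _ _)} eq = case hyperedge-block d d′ eq of λ ()
  hyperedge-injective {d@(pair _ _)} {d′@(pair _ _)} eq with refl ← hyperedge-block d d′ eq = refl

  ∣hyperedge∣ : ∀ {d} → Unique (vertices d) → ∣ hyperedge d ∣ ≡ length (vertices d)
  ∣hyperedge∣ {d} u = trans (∣fromList∣ (Unique.map⁺ encode-injective u)) (length-map encode (vertices d))

  ∣star∣ : ∀ b i → ∣ hyperedge (star b i) ∣ ≡ suc w
  ∣star∣ b i = trans
    (∣hyperedge∣ {star b i} (All.tabulate (λ { p refl → centre∉cells (starBlock b) id p }) ∷ cells-unique (starBlock b) id id))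
    (cong suc (length-tabulate (cell (starBlock b))))

  ∣pair∣ : ∀ {i j} → i ≢ j → ∣ hyperedge (pair i j) ∣ ≡ suc w
  ∣pair∣ {i} {j} i≢j = trans
    (∣hyperedge∣ {pair i j} (All.tabulate (λ { (here refl) refl → i≢j refl ; (there p) refl → centre∉cells (pairBlock i j) suc p })
      ∷ All.tabulate (λ { p refl → centre∉cells (pairBlock i j) suc p }) ∷ cells-unique (pairBlock i j) suc Fin.suc-injective))
    (cong (2 +_) (length-tabulate (cell (pairBlock i j) ∘ suc)))

  spokes : List Spoke
  spokes = cartesianProductWith star (allFin q) (allFin f) ++ cartesianProductWith pair (allFin f) (allFin f)

  ∈-spokes : ∀ d → d List.∈ spokes
  ∈-spokes (star b i) = ∈-++⁺ˡ (∈-cartesianProductWith⁺ star (∈-allFin b) (∈-allFin i))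
  ∈-spokes (pair i j) = ∈-++⁺ʳ (cartesianProductWith star (allFin q) (allFin f))
    (∈-cartesianProductWith⁺ pair (∈-allFin i) (∈-allFin j))

  hasSize? : (e : Subset order) → Dec (∣ e ∣ ≡ suc w)
  hasSize? e = ∣ e ∣ ℕ.≟ suc w

  -- The size filter removes the degenerate hyperedges pair i i.
  base : UHypergraph (suc w) order
  base = record
    { hedges  = deduplicate _≟ˢ_ sized
    ; uniform = All.tabulate λ e∈ → proj₂ (∈-filter⁻ hasSize? {xs = map hyperedge spokes} (∈-deduplicate⁻ _≟ˢ_ sized e∈))
    ; hunique = DecUnique.deduplicate-! _≟ˢ_ sized }
    where sized = filter hasSize? (map hyperedge spokes)

  ∈-base⁺ : ∀ d → ∣ hyperedge d ∣ ≡ suc w → hyperedge d List.∈ hedges base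
  ∈-base⁺ d size = ∈-deduplicate⁺ _≟ˢ_ (∈-filter⁺ hasSize? (∈-map⁺ hyperedge (∈-spokes d)) size)

  ∈-base⁻ : ∀ {e} → e List.∈ hedges base → ∃ λ d → e ≡ hyperedge d
  ∈-base⁻ e∈ with ∈-map⁻ hyperedge (proj₁ (∈-filter⁻ hasSize? {xs = map hyperedge spokes} (∈-deduplicate⁻ _≟ˢ_ _ e∈)))
  ... | d , _ , eq = d , eq

  -- Along a cycle avoiding S the block can change only at centre i₀, so it is constant; and
  -- hyperedges on one block are told apart by their f centres.
  base-free : (F : Graph m) → HasEdge F → (∀ {ℓ} → HasCycle F ℓ → f < ℓ) →
    (∀ S → AcyclicAfterDeleting F S → f ≤ ∣ S ∣) → ¬ ContainsBerge F (hedges base)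
  base-free {m} F (_ , e₀∈) girth>f feedback≥f contains = ℕ.<⇒≱ ∣S∣<f (feedback≥f S acyclic)
    where
    open BergeCopy (containsBerge⁻ F (hunique base) contains)

    spoke : Fin (size F) → Spoke
    spoke i = proj₁ (∈-base⁻ (edge∈ i))

    edge≡ : ∀ i → edge i ≡ hyperedge (spoke i)
    edge≡ i = proj₂ (∈-base⁻ (edge∈ i))

    spoke-injective : Injective _≡_ _≡_ spoke
    spoke-injective {i} {j} eq = edge-injective (trans (edge≡ i) (trans (cong hyperedge eq) (sym (edge≡ j))))

    image : Fin m → Vertex
    image u = decode (vertex u)

    image-injective : Injective _≡_ _≡_ image
    image-injective = vertex-injective ∘ decode-injective

    image∈ : ∀ {i u v} → Ends F i u v → image u List.∈ vertices (spoke i)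
    image∈ {i} (inj₁ (refl , _)) = ∈-hyperedge⁻ {d = spoke i} (subst (_ ∈_) (edge≡ i) (source∈ i))
    image∈ {i} (inj₂ (_ , refl)) = ∈-hyperedge⁻ {d = spoke i} (subst (_ ∈_) (edge≡ i) (target∈ i))

    -- Any centre would do; the edge given by `HasEdge` lies in some base hyperedge and so provides
    -- one.
    i₀ : Fin f
    i₀ = centreOf (spoke (index e₀∈))

    Other : Vertex → Set
    Other v = ∃ λ j → j ≢ i₀ × v ≡ centre j

    other? : Decidable Other
    other? (centre j) = map′ (λ j≢i₀ → j , j≢i₀ , refl) (λ { (_ , j≢i₀ , refl) → j≢i₀ }) (¬? (j ≟ i₀))
    other? (cell _ _) = no λ { (_ , _ , ()) }
    other? (spare _) = no λ { (_ , _ , ()) }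

    S : Subset m
    S = comprehension (other? ∘ image)

    ∈S : ∀ {u} → u ∈ S → Other (image u)
    ∈S = ∈-comprehension⁻ (other? ∘ image)

    ∣S∣<f : ∣ S ∣ < f
    -- Vertices of `S` sit on distinct centres, none of them `i₀`.
    ∣S∣<f = ∣p∣<-injection S (proj₁ ∘ ∈S)
      (λ x∈ y∈ eq → image-injective (trans (proj₂ (proj₂ (∈S x∈))) (trans (cong centre eq) (sym (proj₂ (proj₂ (∈S y∈)))))))
      i₀ (proj₁ ∘ proj₂ ∘ ∈S)

    acyclic : AcyclicAfterDeleting F S
    acyclic _ (r , refl , c , c-inj , path , close , c∉S) =
      ℕ.<⇒≱ (girth>f (r , refl , c , c-inj , path , close , λ _ → ∉⊥))
        -- All hyperedges of the cycle lie on one block, so they have distinct centres and the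
        -- length of the cycle is at most `f`.
        (Fin.injective⇒≤ {f = centreOf ∘ spoke ∘ a} λ {i} {j} eq → a-injective
          (spoke-injective (block-centre-injective (trans (constant i) (sym (constant j))) eq)))
      where
      adjacent : ∀ {i j} → Next i j → Adj F (c i) (c j)
      adjacent = cycle-adj F {S} c path close

      a : Fin (3 + r) → Fin (size F)
      a i = proj₁ (adj-edge F (adjacent (proj₂ (next i))))

      ends : ∀ {i j} → Next i j → Ends F (a i) (c i) (c j)
      ends {i} i→j = subst (Ends F (a i) (c i) ∘ c) (Next-functional (proj₂ (next i)) i→j)
        (proj₂ (adj-edge F (adjacent (proj₂ (next i)))))

      a-injective : Injective _≡_ _≡_ a
      a-injective {i} {j} eq = cycle-edges-distinct F {S} c c-inj (proj₂ (next i)) (proj₂ (next j)) (ends (proj₂ (next i)))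
        (subst (λ x → Ends F x _ _) (sym eq) (ends (proj₂ (next j))))

      At₀ : Fin (3 + r) → Set
      At₀ j = image (c j) ≡ centre i₀

      at₀? : Decidable At₀
      at₀? j with image (c j)
      ... | centre i = map′ (cong centre) (λ { refl → refl }) (i ≟ i₀)
      ... | cell _ _ = no λ ()
      ... | spare _ = no λ ()

      step : ∀ {i j} → Next i j → ¬ At₀ j → block (spoke (a i)) ≡ block (spoke (a j))
      step {i} {j} i→j ¬at₀ = sameBlock (image (c j)) refl
        (image∈ (Ends-swap F (ends i→j))) (image∈ (ends (proj₂ (next j))))
        where
        sameBlock : ∀ v → image (c j) ≡ v → image (c j) List.∈ vertices (spoke (a i)) →
          image (c j) List.∈ vertices (spoke (a j)) → block (spoke (a i)) ≡ block (spoke (a j))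
        -- A vertex placed on a centre other than `i₀` belongs to `S`, which the cycle avoids.
        sameBlock (centre x) eq _ _ = contradiction
          (∈-comprehension⁺ (other? ∘ image) (x , (λ { refl → ¬at₀ eq }) , eq)) (c∉S j)
        sameBlock (cell B t) eq p p′ rewrite eq =
          trans (sym (cell∈⇒block {d = spoke (a i)} p)) (cell∈⇒block {d = spoke (a j)} p′)
        sameBlock (spare x) eq p _ rewrite eq = contradiction p (spare∉ {d = spoke (a i)})

      constant : ∀ i → block (spoke (a i)) ≡ block (spoke (a zero))
      constant = cyclic-constant at₀? (λ p p′ → c-inj (image-injective (trans p (sym p′)))) step

-- Completing a Berge copy of `F` from a dense core

override : {P : Set} → Dec P → A → A → A
override (yes _) a _ = a
override (no _) _ b = b

override-yes : {P : Set} (P? : Dec P) {a b : A} → P → override P? a b ≡ a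
override-yes (yes _) _ = refl
override-yes (no ¬p) p = contradiction p ¬p

override-no : {P : Set} (P? : Dec P) {a b : A} → ¬ P → override P? a b ≡ b
override-no (yes p) ¬p = contradiction p ¬p
override-no (no _) _ = refl

isHere : {x : A} {xs : List A} → x List.∈ xs → Bool
isHere (here _) = true
isHere (there _) = false

-- Two edges assigned to one base hyperedge each fill both of its slots, in the same or in opposite
-- order.
distinct-Bools : ∀ {a a′ b b′ : Bool} → a ≢ a′ → b ≢ b′ → (a ≡ b × a′ ≡ b′) ⊎ (a ≡ b′ × a′ ≡ b)
distinct-Bools {false} {false} a≢a′ _ = contradiction refl a≢a′
distinct-Bools {true} {true} a≢a′ _ = contradiction refl a≢a′
distinct-Bools {false} {true} {false} {true} _ _ = inj₁ (refl , refl)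
distinct-Bools {false} {true} {true} {false} _ _ = inj₂ (refl , refl)
distinct-Bools {true} {false} {true} {false} _ _ = inj₁ (refl , refl)
distinct-Bools {true} {false} {false} {true} _ _ = inj₂ (refl , refl)
distinct-Bools {b = false} {false} _ b≢b′ = contradiction refl b≢b′
distinct-Bools {b = true} {true} _ b≢b′ = contradiction refl b≢b′

module Embedding (f κ q r : ℕ) (b₀ : Fin q) (F : Graph m) (W : Subset m) (acyclic : AcyclicAfterDeleting F W) where
  open Construction f κ q r

  -- What a new leaf must avoid. The blocks of all `m` vertices are included, placed or not, so the
  -- length is the same at every stage of the embedding.
  blocked : (Fin m → Fin q) → List Vertex
  blocked bl = tabulate centre ++ (tabulate (pairCell ∘ remQuot w) ++
    (tabulate spare ++ tabulate λ (x : Fin (m * w)) → starCell (bl (proj₁ (remQuot {m} w x)) , proj₂ (remQuot {m} w x))))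

  length-blocked : ∀ bl → length (blocked bl) ≡ f + (f * f * w + (r + m * w))
  length-blocked bl =
    trans (length-++ (tabulate centre)) (cong₂ _+_ (length-tabulate centre)
    (trans (length-++ (tabulate (pairCell ∘ remQuot w))) (cong₂ _+_ (length-tabulate (pairCell ∘ remQuot w))
    (trans (length-++ (tabulate spare)) (cong₂ _+_ (length-tabulate spare) (length-tabulate _))))))

  unblocked : ∀ bl v → ¬ (v List.∈ blocked bl) →
    ∃ λ b → ∃ λ t → v ≡ cell (starBlock b) t × ∀ u → bl u ≢ b
  unblocked bl (centre i) v∉ = contradiction (∈-++⁺ˡ (∈-tabulate⁺ {f = centre} i)) v∉
  unblocked bl (spare x) v∉ = contradiction
    (∈-++⁺ʳ (tabulate centre) (∈-++⁺ʳ (tabulate (pairCell ∘ remQuot w)) (∈-++⁺ˡ (∈-tabulate⁺ {f = spare} x)))) v∉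
  unblocked bl (cell (pairBlock i j) t) v∉ = contradiction
    (∈-++⁺ʳ (tabulate centre) (∈-++⁺ˡ (subst (List._∈ tabulate (pairCell ∘ remQuot w)) eq
      (∈-tabulate⁺ {f = pairCell ∘ remQuot w} (combine (combine i j) t))))) v∉
    where
    eq : pairCell (remQuot w (combine (combine i j) t)) ≡ cell (pairBlock i j) t
    eq = trans (cong pairCell (Fin.remQuot-combine (combine i j) t))
               (cong (λ ij → cell (pairBlock (proj₁ ij) (proj₂ ij)) t) (Fin.remQuot-combine i j))
  unblocked bl (cell (starBlock b) t) v∉ = b , t , refl , λ { u refl → v∉
    (∈-++⁺ʳ (tabulate centre) (∈-++⁺ʳ (tabulate (pairCell ∘ remQuot w)) (∈-++⁺ʳ (tabulate spare)
      (subst (List._∈ tabulate used) (cong (λ ut → starCell (bl (proj₁ ut) , proj₂ ut)) (Fin.remQuot-combine u t))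
        (∈-tabulate⁺ {f = used} (combine u t)))))) }
    where
    used : Fin (m * w) → Vertex
    used x = starCell (bl (proj₁ (remQuot {m} w x)) , proj₂ (remQuot {m} w x))

  Within : Subset m → Fin (size F) → Set
  Within A i = source F i ∈ A × target F i ∈ A

  module _ {E : List (Subset order)} {D : ℕ} (K : DenseCore D E)
    (bound : size F + 2 ^ (f + (f * f * w + (r + m * w))) ≤ D)
    (inhabitedEdges : ∀ {e} → e List.∈ E → ∃ (_∈ e)) where
    open DenseCore K

    -- A Berge copy of the subgraph induced on `A`; the total functions are constrained only there.
    -- Distinct blocks, rather than just distinct points, ensure that a spoke meets at most one
    -- forest vertex and that no base hyperedge serves a forest edge. By `covered`, even a vertex
    -- with no placed edge has large degree in the core.
    record ForestCopy (A : Subset m) : Set where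
      field
        bl   : Fin m → Fin q
        pos  : Fin m → Fin w
        bl-injective : ∀ {u v} → u ∈ A → v ∈ A → bl u ≡ bl v → u ≡ v
        edge : Fin (size F) → Subset order
      point : Fin m → Fin order
      point u = encode (cell (starBlock (bl u)) (pos u))
      field
        covered : ∀ {u} → u ∈ A → ∃ λ e → e List.∈ core × point u ∈ e
        edge∈   : ∀ {i} → Within A i → edge i List.∈ core
        source∈ : ∀ {i} → Within A i → point (source F i) ∈ edge i
        target∈ : ∀ {i} → Within A i → point (target F i) ∈ edge i
        edge-injective : ∀ {i j} → Within A i → Within A j → edge i ≡ edge j → i ≡ j

    attachLeaf : ∀ {A v} → v ∈ A →
      (∀ {u u′} → u ∈ A → u′ ∈ A → Adj F v u → Adj F v u′ → u ≡ u′) → ForestCopy (A - v) → ForestCopy A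
    attachLeaf {A} {v} v∈A leaf C = go anchor
      where
      open ForestCopy C

      -v : ∀ {u} → u ∈ A → u ≢ v → u ∈ A - v
      -v = x∈p∧x≢y⇒x∈p-y

      anchor : ∃ λ x → (∃ λ e → e List.∈ core × x ∈ e) × (∀ {u} → u ∈ A → Adj F v u → point u ≡ x)
      anchor with Fin.any? (λ u → (u ∈? A) ×-dec adj? F v u)
      ... | yes (u , u∈A , a) = point u , covered (-v u∈A (adj-irrefl F a ∘ sym)) ,
                                λ u′∈A a′ → cong point (leaf u′∈A u∈A a′ a)
      -- Without a neighbour in `A`, any vertex of any core hyperedge can serve as `x`.
      ... | no none = let e , e∈ = nonempty ; x , x∈e = inhabitedEdges (core⊆ e∈) in
                      x , (e , e∈ , x∈e) , λ u∈A a → contradiction (_ , u∈A , a) none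

      go : _ → ForestCopy A
      go (x , (_ , e₀∈ , x∈e₀) , x-neighbour)
        -- All values of `edge` count as used, including those of edges outside `A`; hence `size F`
        -- in the bound.
        with escape (tabulate edge) (map encode (blocked bl)) (Unique.filter⁺ (x ∈?_) core-!)
               (ℕ.≤-<-trans (ℕ.≤-trans (ℕ.≤-reflexive (cong₂ (λ a b → a + 2 ^ b) (length-tabulate edge)
                 (trans (length-map encode (blocked bl)) (length-blocked bl)))) bound) (dense e₀∈ x∈e₀))
      ... | e , e∈filter , e∉ , y , y∈e , y∉
        with unblocked bl (decode y) (λ p → y∉ (subst (List._∈ _) (encode-decode y) (∈-map⁺ encode p)))
      ... | b , t , y≡ , b-fresh = record
        { bl = bl′ ; pos = pos′ ; bl-injective = bl′-injective ; edge = edge′ ; covered = covered′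
        ; edge∈ = edge′∈ ; source∈ = λ within → proj₁ (ends∈ within) ; target∈ = λ within → proj₂ (ends∈ within)
        ; edge-injective = edge′-injective }
        where
        e∈core : e List.∈ core
        e∈core = proj₁ (∈-filter⁻ (x ∈?_) {xs = core} e∈filter)
        x∈e : x ∈ e
        x∈e = proj₂ (∈-filter⁻ (x ∈?_) {xs = core} e∈filter)

        bl′ : Fin m → Fin q
        bl′ u = override (u ≟ v) b (bl u)
        pos′ : Fin m → Fin w
        pos′ u = override (u ≟ v) t (pos u)
        point′ : Fin m → Fin order
        point′ u = encode (cell (starBlock (bl′ u)) (pos′ u))

        Touches : Fin (size F) → Set
        Touches i = ∃ λ u → Ends F i v u
        touches? : ∀ i → Dec (Touches i)
        touches? i with source F i ≟ v | target F i ≟ v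
        ... | yes p | _ = yes (_ , inj₁ (p , refl))
        ... | no _ | yes p = yes (_ , inj₂ (refl , p))
        ... | no s≢v | no t≢v = no λ { (_ , inj₁ (p , _)) → s≢v p ; (_ , inj₂ (_ , p)) → t≢v p }

        edge′ : Fin (size F) → Subset order
        edge′ i = override (touches? i) e (edge i)

        point′-v : point′ v ∈ e
        point′-v = subst (_∈ e) (sym (trans (cong₂ (λ b t → encode (cell (starBlock b) t))
          (override-yes (v ≟ v) refl) (override-yes (v ≟ v) refl))
          (trans (cong encode (sym y≡)) (encode-decode y)))) y∈e

        point′-≢ : ∀ {u} → u ≢ v → point u ≡ point′ u
        point′-≢ {u} u≢v = sym (cong₂ (λ b t → encode (cell (starBlock b) t))
          (override-no (u ≟ v) u≢v) (override-no (u ≟ v) u≢v))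

        point′-neighbour : ∀ {u} → u ∈ A → Adj F v u → point′ u ∈ e
        point′-neighbour u∈A a = subst (_∈ e)
          (trans (sym (x-neighbour u∈A a)) (point′-≢ (adj-irrefl F a ∘ sym))) x∈e

        bl′-injective : ∀ {u u′} → u ∈ A → u′ ∈ A → bl′ u ≡ bl′ u′ → u ≡ u′
        bl′-injective {u} {u′} u∈A u′∈A eq with u ≟ v | u′ ≟ v
        ... | yes refl | yes refl = refl
        ... | yes refl | no _ = contradiction (sym eq) (b-fresh u′)
        ... | no _ | yes refl = contradiction eq (b-fresh u)
        ... | no u≢v | no u′≢v = bl-injective (-v u∈A u≢v) (-v u′∈A u′≢v) eq

        covered′ : ∀ {u} → u ∈ A → ∃ λ e → e List.∈ core × point′ u ∈ e
        covered′ {u} u∈A = case u ≟ v of λ where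
          (yes refl) → e , e∈core , point′-v
          (no u≢v) → let e′ , e′∈ , p = covered (-v u∈A u≢v) in e′ , e′∈ , subst (_∈ e′) (point′-≢ u≢v) p

        remains : ∀ {i} → Within A i → ¬ Touches i → Within (A - v) i
        remains (s∈A , t∈A) ¬touches =
          -v s∈A (λ p → ¬touches (_ , inj₁ (p , refl))) , -v t∈A (λ p → ¬touches (_ , inj₂ (refl , p)))

        far∈ : ∀ {i u} → Within A i → Ends F i v u → u ∈ A
        far∈ (_ , t∈A) (inj₁ (_ , refl)) = t∈A
        far∈ (s∈A , _) (inj₂ (refl , _)) = s∈A

        edge′∈ : ∀ {i} → Within A i → edge′ i List.∈ core
        edge′∈ {i} within with touches? i
        ... | yes _ = e∈core
        ... | no ¬touches = edge∈ (remains within ¬touches)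

        ends∈ : ∀ {i} → Within A i → point′ (source F i) ∈ edge′ i × point′ (target F i) ∈ edge′ i
        ends∈ {i} within with touches? i
        ... | yes (_ , ends@(inj₁ (refl , refl))) = point′-v , point′-neighbour (far∈ within ends) (Ends-adj F ends)
        ... | yes (_ , ends@(inj₂ (refl , refl))) = point′-neighbour (far∈ within ends) (Ends-adj F ends) , point′-v
        ... | no ¬touches =
          subst (_∈ edge i) (point′-≢ (λ p → ¬touches (_ , inj₁ (p , refl)))) (source∈ (remains within ¬touches)) ,
          subst (_∈ edge i) (point′-≢ (λ p → ¬touches (_ , inj₂ (refl , p)))) (target∈ (remains within ¬touches))

        edge′-injective : ∀ {i j} → Within A i → Within A j → edge′ i ≡ edge′ j → i ≡ j
        edge′-injective {i} {j} wi wj eq with touches? i | touches? j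
        -- Both edges join `v` to its only neighbour in `A`.
        ... | yes (u , ends) | yes (u′ , ends′) = Ends-unique F ends
          (subst (Ends F j v) (leaf (far∈ wj ends′) (far∈ wi ends) (Ends-adj F ends′) (Ends-adj F ends)) ends′)
        ... | yes _ | no _ = contradiction (subst (List._∈ tabulate edge) (sym eq) (∈-tabulate⁺ j)) e∉
        ... | no _ | yes _ = contradiction (subst (List._∈ tabulate edge) eq (∈-tabulate⁺ i)) e∉
        ... | no ¬ti | no ¬tj = edge-injective (remains wi ¬ti) (remains wj ¬tj) eq

    -- Deleting `W` leaves a forest, so leaves can be removed from `A` one by one and attached again
    -- in reverse order. `h` bounds the number of removals.
    forestCopy : ∀ h (A : Subset m) → ∣ A ∣ ≤ h → (∀ {u} → u ∈ A → u ∉ W) → ForestCopy A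
    forestCopy h A ∣A∣≤h A∩W=∅ with nonempty? A
    -- No vertex is placed yet; `b₀` and the other values are placeholders.
    ... | no empty = record
      { bl = λ _ → b₀ ; pos = λ _ → zero ; bl-injective = λ u∈A → contradiction (_ , u∈A) empty
      ; edge = λ _ → emptySet ; covered = λ u∈A → contradiction (_ , u∈A) empty
      ; edge∈ = absurd ; source∈ = absurd ; target∈ = absurd ; edge-injective = absurd }
      where
      absurd : ∀ {i} {X : Set} → Within A i → X
      absurd (s∈A , _) = contradiction (_ , s∈A) empty
    forestCopy zero A ∣A∣≤h _ | yes (_ , v∈A) =
      contradiction (ℕ.<-≤-trans (x∈p⇒∣p-x∣<∣p∣ v∈A) ∣A∣≤h) λ ()
    forestCopy (suc h) A ∣A∣≤h A∩W=∅ | yes (_ , v∈A) with leaf F A W A∩W=∅ acyclic v∈A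
    ... | v , v∈A , v-leaf = attachLeaf v∈A v-leaf
      (forestCopy h (A - v) (s≤s⁻¹ (ℕ.≤-trans (x∈p⇒∣p-x∣<∣p∣ v∈A) ∣A∣≤h)) (A∩W=∅ ∘ p─q⊆p A _))

    module _ (E⊇base : ∀ {e} → e List.∈ hedges base → e List.∈ E)
      (ι : ∀ {u} → u ∈ W → Fin f) (ι-injective : ∀ {u v} (p : u ∈ W) (p′ : v ∈ W) → ι p ≡ ι p′ → u ≡ v) where
      open ForestCopy (forestCopy ∣ ∁ W ∣ (∁ W) ℕ.≤-refl x∈∁p⇒x∉p)

      place : ∀ {u} → Dec (u ∈ W) → Vertex
      place (yes u∈W) = centre (ι u∈W)
      place {u} (no _) = cell (starBlock (bl u)) (pos u)

      image : Fin m → Vertex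
      image u = place (u ∈? W)

      image-∉ : ∀ {u} → u ∉ W → image u ≡ cell (starBlock (bl u)) (pos u)
      image-∉ {u} u∉W with u ∈? W
      ... | yes u∈W = contradiction u∈W u∉W
      ... | no _ = refl

      image-centre : ∀ {u v i} → image u ≡ centre i → image v ≡ centre i → u ≡ v
      image-centre {u} {v} eq eq′ with u ∈? W | v ∈? W
      image-centre refl eq′ | yes p | yes p′ = ι-injective p p′ (sym (centre-injective eq′))
        where
        centre-injective : ∀ {i j} → centre i ≡ centre j → i ≡ j
        centre-injective refl = refl

      image-cell : ∀ {u v b t t′} → image u ≡ cell (starBlock b) t → image v ≡ cell (starBlock b) t′ → u ≡ v
      image-cell {u} {v} eq eq′ with u ∈? W | v ∈? W
      image-cell refl eq′ | no u∉ | no v∉ = bl-injective (x∉p⇒x∈∁p u∉) (x∉p⇒x∈∁p v∉) (sym (block-injective eq′))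
        where
        block-injective : ∀ {b b′ t t′} → cell (starBlock b) t ≡ cell (starBlock b′) t′ → b ≡ b′
        block-injective refl = refl

      image-pairCell : ∀ {u i j t} → image u ≢ cell (pairBlock i j) t
      image-pairCell {u} eq with u ∈? W
      image-pairCell () | yes _
      image-pairCell () | no _

      image-injective : Injective _≡_ _≡_ image
      image-injective {u} {v} eq = by (image v) eq refl
        where
        by : ∀ x → image u ≡ x → image v ≡ x → u ≡ v
        by (centre i) = image-centre
        by (cell (starBlock b) t) = image-cell
        by (cell (pairBlock i j) t) p = contradiction p image-pairCell
        by (spare x) p with u ∈? W
        by (spare x) () | yes _
        by (spare x) () | no _

      -- A base hyperedge contains at most two vertices of the copy: one heads its vertex list, one does not.
      slot-injective : ∀ d {u v} (p : image u List.∈ vertices d) (p′ : image v List.∈ vertices d) →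
        isHere p ≡ isHere p′ → u ≡ v
      slot-injective (star b i) (here p) (here p′) _ = image-centre p p′
      slot-injective (pair i j) (here p) (here p′) _ = image-centre p p′
      slot-injective (star b i) (there p) (there p′) _ =
        image-cell (proj₂ (∈-cells⁻ (starBlock b) id p)) (proj₂ (∈-cells⁻ (starBlock b) id p′))
      slot-injective (pair i j) (there (here p)) (there (here p′)) _ = image-centre p p′
      slot-injective (pair i j) (there (there p)) _ _ =
        contradiction (proj₂ (∈-cells⁻ (pairBlock i j) suc p)) image-pairCell
      slot-injective (pair i j) (there (here _)) (there (there p)) _ =
        contradiction (proj₂ (∈-cells⁻ (pairBlock i j) suc p)) image-pairCell

      -- The source of the hyperedge for an edge of `F`: a base spoke if the edge meets `W`, the
      -- forest copy otherwise. The memberships stored in `spoke` serve both incidence and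
      -- injectivity.
      data Kind (i : Fin (size F)) : Set where
        spoke  : ∀ d → ∣ hyperedge d ∣ ≡ suc w →
                 image (source F i) List.∈ vertices d → image (target F i) List.∈ vertices d → Kind i
        forest : source F i ∉ W → target F i ∉ W → Kind i

      source≢target : ∀ i → source F i ≢ target F i
      source≢target i = adj-irrefl F (edge-adj F i)

      kind : ∀ i → Kind i
      kind i with source F i ∈? W in s | target F i ∈? W in t
      -- The two ends have distinct centres, so this pair spoke is not degenerate and survives the
      -- size filter of `base`.
      ... | yes p | yes p′ = spoke (pair (ι p) (ι p′)) (∣pair∣ (source≢target i ∘ ι-injective p p′))
                (subst (List._∈ _) (sym (cong place s)) (here refl))
                (subst (List._∈ _) (sym (cong place t)) (there (here refl)))
      -- The star joins the centre of the end in `W` to the block of the forest end.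
      ... | yes p | no _ = spoke (star (bl (target F i)) (ι p)) (∣star∣ _ _)
                (subst (List._∈ _) (sym (cong place s)) (here refl))
                (subst (List._∈ _) (sym (cong place t)) (there
                  (∈-tabulate⁺ {f = cell (starBlock (bl (target F i)))} (pos (target F i)))))
      ... | no _ | yes p = spoke (star (bl (source F i)) (ι p)) (∣star∣ _ _)
                (subst (List._∈ _) (sym (cong place s)) (there
                  (∈-tabulate⁺ {f = cell (starBlock (bl (source F i)))} (pos (source F i)))))
                (subst (List._∈ _) (sym (cong place t)) (here refl))
      ... | no s∉W | no t∉W = forest s∉W t∉W

      kindEdge : ∀ {i} → Kind i → Subset order
      kindEdge (spoke d _ _ _) = hyperedge d
      kindEdge {i} (forest _ _) = edge i

      within : ∀ {i} → source F i ∉ W → target F i ∉ W → Within (∁ W) i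
      within s∉W t∉W = x∉p⇒x∈∁p s∉W , x∉p⇒x∈∁p t∉W

      kindEdge∈ : ∀ {i} (x : Kind i) → kindEdge x List.∈ E
      kindEdge∈ (spoke d size _ _) = E⊇base (∈-base⁺ d size)
      kindEdge∈ (forest s∉W t∉W) = core⊆ (edge∈ (within s∉W t∉W))

      kindSource∈ : ∀ {i} (x : Kind i) → encode (image (source F i)) ∈ kindEdge x
      kindSource∈ (spoke d _ s∈ _) = ∈-hyperedge⁺ {d = d} s∈
      kindSource∈ (forest s∉W t∉W) = subst (_∈ _) (cong encode (sym (image-∉ s∉W))) (source∈ (within s∉W t∉W))

      kindTarget∈ : ∀ {i} (x : Kind i) → encode (image (target F i)) ∈ kindEdge x
      kindTarget∈ (spoke d _ _ t∈) = ∈-hyperedge⁺ {d = d} t∈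
      kindTarget∈ (forest s∉W t∉W) = subst (_∈ _) (cong encode (sym (image-∉ t∉W))) (target∈ (within s∉W t∉W))

      -- A forest edge has its ends in two different star blocks, whereas a base hyperedge meets
      -- only one block.
      forest≢hyperedge : ∀ {i} d → source F i ∉ W → target F i ∉ W → hyperedge d ≢ edge i
      forest≢hyperedge {i} d s∉W t∉W eq = source≢target i (bl-injective (x∉p⇒x∈∁p s∉W) (x∉p⇒x∈∁p t∉W)
        (starBlock-injective (trans (inBlock (source∈ (within s∉W t∉W))) (sym (inBlock (target∈ (within s∉W t∉W)))))))
        where
        starBlock-injective : ∀ {b b′} → starBlock b ≡ starBlock b′ → b ≡ b′
        starBlock-injective refl = refl
        inBlock : ∀ {u} → point u ∈ edge i → starBlock (bl u) ≡ block d
        inBlock {u} u∈ = cell∈⇒block {d = d} (subst (List._∈ vertices d) (decode-encode _)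
          (∈-hyperedge⁻ {d = d} (subst (point u ∈_) (sym eq) u∈)))

      -- The critical case is a base hyperedge shared by two edges: its two slots determine two
      -- vertices of `F`, so both edges have the same ends.
      kindEdge-injective : ∀ {i j} (x : Kind i) (y : Kind j) → kindEdge x ≡ kindEdge y → i ≡ j
      kindEdge-injective (forest s∉ t∉) (forest s′∉ t′∉) eq = edge-injective (within s∉ t∉) (within s′∉ t′∉) eq
      kindEdge-injective (spoke d _ _ _) (forest s∉ t∉) eq = contradiction eq (forest≢hyperedge d s∉ t∉)
      kindEdge-injective (forest s∉ t∉) (spoke d _ _ _) eq = contradiction (sym eq) (forest≢hyperedge d s∉ t∉)
      kindEdge-injective {i} {j} (spoke d _ s∈ t∈) (spoke d′ _ s′∈ t′∈) eq with refl ← hyperedge-injective {d} {d′} eq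
        with distinct-Bools (source≢target i ∘ slot-injective d s∈ t∈) (source≢target j ∘ slot-injective d s′∈ t′∈)
      ... | inj₁ (p , p′) = Ends-unique F {v = target F j}
        (inj₁ (slot-injective d s∈ s′∈ p , slot-injective d t∈ t′∈ p′)) (inj₁ (refl , refl))
      ... | inj₂ (p , p′) = Ends-unique F {v = source F j}
        (inj₁ (slot-injective d s∈ t′∈ p , slot-injective d t∈ s′∈ p′)) (inj₂ (refl , refl))

      copy : BergeCopy F E
      copy = record
        { vertex = encode ∘ image ; vertex-injective = image-injective ∘ encode-injective
        ; edge = kindEdge ∘ kind ; edge-injective = kindEdge-injective (kind _) (kind _)
        ; edge∈ = kindEdge∈ ∘ kind ; source∈ = kindSource∈ ∘ kind ; target∈ = kindTarget∈ ∘ kind }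

-- The linear bound

∣p∣≡1+n⇒Nonempty : {p : Subset n} → ∣ p ∣ ≡ suc k → Nonempty p
∣p∣≡1+n⇒Nonempty {p = p} eq = element p i , element∈ p i
  where
  i : Fin ∣ p ∣
  i = subst Fin (sym eq) zero

girth>⇒cycle> : {F : Graph m} (g : Maybe ℕ) {f : ℕ} → IsGirth F g → GirthGreater g f → ∀ {ℓ} → HasCycle F ℓ → f < ℓ
girth>⇒cycle> (just g) (_ , g≤) f<g cycle = ℕ.<-≤-trans f<g (g≤ _ cycle)
girth>⇒cycle> nothing noCycle _ cycle = contradiction cycle (noCycle _)

module _ (F : Graph m) (W : Subset m) (acyclic : AcyclicAfterDeleting F W)
  (minimal : ∀ S → AcyclicAfterDeleting F S → ∣ W ∣ ≤ ∣ S ∣) (hasEdge : HasEdge F)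
  (girth>f : ∀ {ℓ} → HasCycle F ℓ → ∣ W ∣ < ℓ) (κ : ℕ) where

  private
    f = ∣ W ∣
    w = 2 + κ

  -- Hyperedges that cannot extend a partial forest copy: those already used, and those inside the
  -- union of the centres, the pair blocks, the spare vertices and the at most m occupied blocks.
  coefficient : ℕ
  coefficient = size F + 2 ^ (f + (f * f * w + (w + m * w)))

  -- `suc q` guarantees a star block for the placeholder value of the embedding, and `r ≤ w` makes
  -- `coefficient` independent of the number of vertices.
  satAtMost : ∀ q r → r ≤ w → let n = f + (f * f * w + (suc q * w + r)) in
    SatAtMost (3 + κ) n F (coefficient * n)
  -- All subsets of the vertex set were greedy candidates, so `ext` is saturated. Too many
  -- hyperedges would give a dense core and hence a forbidden copy of `F`.
  satAtMost q r r≤w = ext , (free , λ e ∣e∣≡k → saturated (∈-powerset ⊆⊤) ∣e∣≡k) ,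
    ℕ.≮⇒≥ λ big → free (containsBerge⁺ F (copy (denseCore coefficient (hunique ext) big) bound
      (∣p∣≡1+n⇒Nonempty ∘ All.lookup (uniform ext)) ext⊇ (rank W) (rank-injective W)))
    where
    open Construction f κ (suc q) r using (base; base-free)
    open Embedding f κ (suc q) r zero F W acyclic using (copy)
    open Extension (extend F base (base-free F hasEdge girth>f minimal) (powerset ⊤))
    bound : size F + 2 ^ (f + (f * f * w + (r + m * w))) ≤ coefficient
    bound = ℕ.+-monoʳ-≤ (size F) (ℕ.^-monoʳ-≤ 2 (ℕ.+-monoʳ-≤ f (ℕ.+-monoʳ-≤ (f * f * w) (ℕ.+-monoˡ-≤ (m * w) r≤w))))

theorem1p4 : ∀ {m} (F : Graph m) (g : Maybe ℕ) (f k : ℕ) →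
    NoIsolated F → HasEdge F → IsGirth F g → IsFeedbackNumber F f →
    GirthGreater g f → 3 ≤ k →
    Σ ℕ λ C → Σ ℕ λ N → ∀ n → N ≤ n → SatAtMost k n F (C * n)
theorem1p4 F g _ (suc (suc (suc κ))) _ hasEdge isGirth ((W , refl , acyclic) , minimal) g>f (s≤s (s≤s (s≤s z≤n))) =
  C , N , λ n N≤n → subst (λ n → SatAtMost (3 + κ) n F (C * n)) (layout n N≤n)
    (satAtMost F W acyclic minimal hasEdge girth>f κ ((n ∸ N) / w) ((n ∸ N) % w) (ℕ.<⇒≤ (m%n<n (n ∸ N) w)))
  where
  f = ∣ W ∣
  w = 2 + κ
  girth>f : ∀ {ℓ} → HasCycle F ℓ → f < ℓ
  girth>f = girth>⇒cycle> {F = F} g isGirth g>f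
  C = coefficient F W acyclic minimal hasEdge girth>f κ
  -- Space for the centres, the pair blocks and one star block. The other `n ∸ N` vertices form
  -- further star blocks, and the remainder of the division by `w` is left spare.
  N = f + (f * f * w + w)
  regroup : ∀ a b c x y → a + (b + ((c + y) + x)) ≡ (x + y) + (a + (b + c))
  regroup = solve-∀
  layout : ∀ n → N ≤ n → f + (f * f * w + (suc ((n ∸ N) / w) * w + (n ∸ N) % w)) ≡ n
  layout n N≤n = trans (regroup f (f * f * w) w ((n ∸ N) % w) ((n ∸ N) / w * w))
    (trans (cong (_+ N) (sym (m≡m%n+[m/n]*n (n ∸ N) w))) (ℕ.m∸n+n≡m N≤n))
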